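{- For every integer $g\ge 3$, $$\frac{2^{g-2}-1}{g-2}\le f_g\le \frac{2^{g+2}-2}{g+2}.$$ In particular, $N_g\sim 2^{g-1}$ as $g\to\infty$.
   Context: For $g\ge1$ and $\delta=(\delta_1,\dots,\delta_g)\in\{0,1\}^g$, put $\varphi_i=\sum_{j\le i}\delta_j$ ($\varphi_0=0$), $P=\{i\mid\delta_i=1\}$, $Z=\{i\mid\delta_i=0\}$, $\varepsilon_i=2\delta_i-1\in\{\pm1\}$. The permutation $\pi_\delta$ of $\{1,\dots,g\}$ is defined by $\pi_\delta(i)=\varphi_i$ if $i\in P$ and $\pi_\delta(i)=g-(i-\varphi_i)+1$ if $i\in Z$. The cycles of $\pi_\delta$ (fixed points count as cycles) are viewed as subsets of $\{1,\dots,g\}$. For a cycle $C$ put $\varepsilon(C)=\prod_{i\in C}\varepsilon_i$. If $\varepsilon(C)=1$, an orientation of $C$ is a map $t_C:C\to\{\pm1\}$ with $t_C(\pi_\delta(i))=\varepsilon_i t_C(i)$ for all $i\in C$. A cycle $C$ is bad if $C\cap P\ne\emptyset$, $\varepsilon(C)=1$, and there is an orientation $t_C$ with $t_C(i)=1$ for all $i\in C\cap P$; this orientation is then unique and $t_C$ denotes it. A cycle that is not bad is good. The cycle graph $\Gamma_\delta$ is the directed graph whose vertices are the cycles of $\pi_\delta$, with an arrow $C\to C'$ iff $C\ne C'$, $C'$ is bad, and there are $i\in C\cap P$, $j\in C'\cap Z$ with $i<j$ and $t_{C'}(j)=1$. Condition $(*)_\delta$: every bad cycle is reachable in $\Gamma_\delta$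 by a directed path starting from a good cycle. $N_g$ is the number of $\delta\in\{0,1\}^g$ such that $(*)_\delta$ holds (for any odd prime $p$, this is also the number of Ekedahl-Oort strata of the moduli stack $\mathcal A_g$ of principally polarized abelian varieties of dimension $g$ in characteristic $p$ that meet the supersingular locus). Put $f_g=2^{g-1}-N_g$; since $(*)_\delta$ fails whenever $\delta_1=1$, $f_g$ is the number of $\delta\in\{0,1\}^g$ with $\delta_1=0$ for which $(*)_\delta$ fails. -}

module Defs where

open import Data.Bool.Base using (Bool; true; false; if_then_else_)
import Data.Bool.Properties as Bool
open import Data.Fin.Base using (Fin; zero; suc; toℕ; fromℕ<) renaming (_<_ to _<ᶠ_)
open import Data.Fin.Properties using (any?; all?; _<?_)
open import Data.Fin.Subset using (Subset; _∈_; _∩_; ∁; ⋃; ⁅_⁆; Nonempty)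
open import Data.Fin.Subset.Properties using (_∈?_; nonempty?)
open import Data.Integer.Base as ℤ using (ℤ; +_)
open import Data.List.Base
  using (List; []; _∷_; map; filter; foldr; length; iterate; allFin; cartesianProductWith)
open import Data.List.Membership.Propositional using (find; lose) renaming (_∈_ to _∈ˡ_)
open import Data.List.Membership.Propositional.Properties
  using (∈-cartesianProductWith⁺; ∈-map⁺; ∈-allFin)
open import Data.List.Relation.Unary.Any using (here; there) renaming (any? to anyˡ?)
open import Data.Nat.Base as ℕ
  using (ℕ; zero; suc; pred; _+_; _∸_; _^_; _≤_; _<_; z≤n; s≤s; NonZero; >-nonZero)
import Data.Nat.Properties as ℕ
open import Data.Product.Base using (∃; _×_; _,_)
open import Data.Rational.Unnormalised.Base as ℚᵘ using (ℚᵘ; 0ℚᵘ)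
open import Data.Sign.Base as Sign using (Sign)
import Data.Sign.Properties as Sign
open import Data.Sum.Base using (_⊎_; inj₁; inj₂)
open import Data.Vec.Base using (Vec; []; _∷_; lookup)
open import Data.Vec.Properties using (≡-dec)
open import Relation.Binary.Construct.Closure.ReflexiveTransitive using (Star; ε; _◅_; _◅◅_)
open import Relation.Binary.PropositionalEquality using (_≡_; _≢_; refl)
open import Relation.Nullary using (¬_; Dec; ¬?; _×-dec_; _⊎-dec_; _→-dec_)
open import Relation.Nullary.Decidable using (map′)

vecs : {A : Set} → List A → (n : ℕ) → List (Vec A n)
vecs xs zero    = [] ∷ []
vecs xs (suc n) = cartesianProductWith _∷_ xs (vecs xs n)

-- A word δ ∈ {0,1}^g, with 0 = false and 1 = true. As Subset g is Vec Bool g,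
-- δ is itself the subset P and ∁ δ is Z.  The index i ∈ {1,…,g} of the
-- mathematics is the element of Fin g whose toℕ is i − 1.

Word : ℕ → Set
Word g = Vec Bool g

words : (g : ℕ) → List (Word g)
words = vecs (false ∷ true ∷ [])

P Z : ∀ {g} → Word g → Subset g
P δ = δ
Z δ = ∁ δ

bit : Bool → ℕ
bit b = if b then 1 else 0

φ : ∀ {g} → Word g → Fin g → ℕ
φ (b ∷ δ) zero    = bit b
φ (b ∷ δ) (suc i) = bit b + φ δ i

sgn : ∀ {g} → Word g → Fin g → Sign
sgn δ i = if lookup δ i then Sign.+ else Sign.-

-- π₁ is the formula with values in {1,…,g}; π shifts it to Fin g.

π₁ : ∀ {g} → Word g → Fin g → ℕ
π₁ {g} δ i = if lookup δ i then φ δ i else g ∸ (suc (toℕ i) ∸ φ δ i) + 1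

private
  bit≤1 : ∀ b → bit b ≤ 1
  bit≤1 true  = s≤s z≤n
  bit≤1 false = z≤n

  φ≤ : ∀ {g} (δ : Word g) i → φ δ i ≤ suc (toℕ i)
  φ≤ (b ∷ δ) zero    = bit≤1 b
  φ≤ (b ∷ δ) (suc i) = ℕ.+-mono-≤ (bit≤1 b) (φ≤ δ i)

  φ< : ∀ {g} (δ : Word g) i → lookup δ i ≡ false → φ δ i ≤ toℕ i
  φ< (false ∷ δ) zero    refl = z≤n
  φ< (b ∷ δ)     (suc i) eq   = ℕ.+-mono-≤ (bit≤1 b) (φ< δ i eq)

  toℕ<g : ∀ {g} (i : Fin g) → toℕ i < g
  toℕ<g zero    = s≤s z≤n
  toℕ<g (suc i) = s≤s (toℕ<g i)

  pred< : ∀ {g v} → Fin g → v ≤ g → pred v < g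
  pred< {v = zero}  i v≤g = ℕ.≤-trans (s≤s z≤n) (toℕ<g i)
  pred< {v = suc v} i v≤g = v≤g

  π₁≤g : ∀ {g} (δ : Word g) i → π₁ δ i ≤ g
  π₁≤g {g} δ i with lookup δ i in eq
  ... | true  = ℕ.≤-trans (φ≤ δ i) (toℕ<g i)
  ... | false = begin
    g ∸ (suc (toℕ i) ∸ φ δ i) + 1  ≤⟨ ℕ.+-monoˡ-≤ 1 (ℕ.∸-monoʳ-≤ g 1≤) ⟩
    g ∸ 1 + 1                      ≡⟨ ℕ.m∸n+n≡m (ℕ.≤-trans (s≤s z≤n) (toℕ<g i)) ⟩
    g                              ∎
    where
    open ℕ.≤-Reasoning
    1≤ : 1 ≤ suc (toℕ i) ∸ φ δ i
    1≤ = ℕ.m<n⇒0<n∸m (s≤s (φ< δ i eq))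

π : ∀ {g} → Word g → Fin g → Fin g
π δ i = fromℕ< (pred< i (π₁≤g δ i))

-- π δ is a permutation of g points, so i, π i, …, π^(g−1) i run through
-- the whole cycle of i (possibly with repetitions).

cycle : ∀ {g} → Word g → Fin g → Subset g
cycle {g} δ i = ⋃ (map ⁅_⁆ (iterate (π δ) i g))

IsCycle : ∀ {g} → Word g → Subset g → Set
IsCycle δ C = ∃ λ i → C ≡ cycle δ i

sgnᶜ : ∀ {g} → Word g → Subset g → Sign
sgnᶜ {g} δ C = foldr Sign._*_ Sign.+ (map (sgn δ) (filter (_∈? C) (allFin g)))

-- A map C → {±1} is given by a sign vector on all of Fin g, of which only the
-- entries in C are ever used.

IsOrientation : ∀ {g} → Word g → Subset g → Vec Sign g → Set
IsOrientation δ C t =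
  ∀ i → i ∈ C → lookup t (π δ i) ≡ sgn δ i Sign.* lookup t i

IsBadOrientation : ∀ {g} → Word g → Subset g → Vec Sign g → Set
IsBadOrientation δ C t =
  IsOrientation δ C t × (∀ i → i ∈ C ∩ P δ → lookup t i ≡ Sign.+)

Bad : ∀ {g} → Word g → Subset g → Set
Bad δ C = Nonempty (C ∩ P δ) × sgnᶜ δ C ≡ Sign.+ × ∃ (IsBadOrientation δ C)

Good : ∀ {g} → Word g → Subset g → Set
Good δ C = ¬ Bad δ C

-- The bad orientation t_{C'} of a bad cycle is unique on C', so it may be
-- introduced by an existential quantifier.

Arrow : ∀ {g} → Word g → Subset g → Subset g → Set
Arrow δ C C′ =
  IsCycle δ C × IsCycle δ C′ × C ≢ C′ × Bad δ C′ ×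
  ∃ λ t → IsBadOrientation δ C′ t ×
    ∃ λ i → ∃ λ j →
      i ∈ C ∩ P δ × j ∈ C′ ∩ Z δ × i <ᶠ j × lookup t j ≡ Sign.+

Condition* : ∀ {g} → Word g → Set
Condition* δ =
  ∀ C → IsCycle δ C → Bad δ C →
  ∃ λ C₀ → IsCycle δ C₀ × Good δ C₀ × Star (Arrow δ) C₀ C

------------------------------------------------------------------------
-- Decidability of Condition*

vecs-complete : {A : Set} (xs : List A) → (∀ x → x ∈ˡ xs) →
                ∀ {n} (v : Vec A n) → v ∈ˡ vecs xs n
vecs-complete xs c []      = here refl
vecs-complete xs c (x ∷ v) =
  ∈-cartesianProductWith⁺ _∷_ (c x) (vecs-complete xs c v)

private
  finite∃? : {A : Set} {Q : A → Set} (xs : List A) → (∀ x → x ∈ˡ xs) →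
             (∀ x → Dec (Q x)) → Dec (∃ Q)
  finite∃? xs c Q? =
    map′ (λ a → let x , _ , q = find a in x , q) (λ (x , q) → lose (c x) q) (anyˡ? Q? xs)

  signs-complete : ∀ s → s ∈ˡ (Sign.+ ∷ Sign.- ∷ [])
  signs-complete Sign.+ = here refl
  signs-complete Sign.- = there (here refl)

  ∃sign? : ∀ {g} {Q : Vec Sign g → Set} → (∀ t → Dec (Q t)) → Dec (∃ Q)
  ∃sign? = finite∃? (vecs _ _) (vecs-complete _ signs-complete)

  -- Paths all of whose interior vertices lie in a given list.

  module Reachability {V : Set} (_⟶_ : V → V → Set)
                      (_≟_ : (x y : V) → Dec (x ≡ y))
                      (_⟶?_ : (x y : V) → Dec (x ⟶ y)) where

    Reach : List V → V → V → Set
    Reach []       x y = x ≡ y ⊎ x ⟶ y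
    Reach (v ∷ vs) x y = Reach vs x y ⊎ (Reach vs x v × Reach vs v y)

    reach? : ∀ vs x y → Dec (Reach vs x y)
    reach? []       x y = (x ≟ y) ⊎-dec (x ⟶? y)
    reach? (v ∷ vs) x y = reach? vs x y ⊎-dec (reach? vs x v ×-dec reach? vs v y)

    sound : ∀ vs {x y} → Reach vs x y → Star _⟶_ x y
    sound []       (inj₁ refl)    = ε
    sound []       (inj₂ e)       = e ◅ ε
    sound (v ∷ vs) (inj₁ p)       = sound vs p
    sound (v ∷ vs) (inj₂ (p , q)) = sound vs p ◅◅ sound vs q

    idle : ∀ vs {x} → Reach vs x x
    idle []       = inj₁ refl
    idle (v ∷ vs) = inj₁ (idle vs)

    edge : ∀ vs {x y} → x ⟶ y → Reach vs x y
    edge []       e = inj₂ e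
    edge (v ∷ vs) e = inj₁ (edge vs e)

    join : ∀ vs {x v y} → v ∈ˡ vs → Reach vs x v → Reach vs v y → Reach vs x y
    join (h ∷ vs) (here refl) p q = inj₂ (toHead p , fromHead q)
      where
      toHead : ∀ {x} → Reach (h ∷ vs) x h → Reach vs x h
      toHead (inj₁ p)       = p
      toHead (inj₂ (p , _)) = p
      fromHead : ∀ {y} → Reach (h ∷ vs) h y → Reach vs h y
      fromHead (inj₁ q)       = q
      fromHead (inj₂ (_ , q)) = q
    join (h ∷ vs) (there m) (inj₁ p)       (inj₁ q)        = inj₁ (join vs m p q)
    join (h ∷ vs) (there m) (inj₁ p)       (inj₂ (q , q′)) = inj₂ (join vs m p q , q′)
    join (h ∷ vs) (there m) (inj₂ (p , p′)) (inj₁ q)       = inj₂ (p , join vs m p′ q)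
    join (h ∷ vs) (there m) (inj₂ (p , _)) (inj₂ (_ , q))  = inj₂ (p , q)

    complete : ∀ vs → (∀ {x y} → x ⟶ y → y ∈ˡ vs) → ∀ {x y} → Star _⟶_ x y → Reach vs x y
    complete vs tgt ε       = idle vs
    complete vs tgt (e ◅ p) = join vs (tgt e) (edge vs e) (complete vs tgt p)

    star? : ∀ vs → (∀ {x y} → x ⟶ y → y ∈ˡ vs) → ∀ x y → Dec (Star _⟶_ x y)
    star? vs tgt x y = map′ (sound vs) (complete vs tgt) (reach? vs x y)

  _≟ˢ_ : ∀ {g} (C D : Subset g) → Dec (C ≡ D)
  _≟ˢ_ = ≡-dec Bool._≟_

module _ {g : ℕ} (δ : Word g) where

  isCycle? : ∀ C → Dec (IsCycle δ C)
  isCycle? C = any? λ i → C ≟ˢ cycle δ i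

  isBadOrientation? : ∀ C t → Dec (IsBadOrientation δ C t)
  isBadOrientation? C t =
    all? (λ i → (i ∈? C) →-dec (lookup t (π δ i) Sign.≟ sgn δ i Sign.* lookup t i))
    ×-dec all? (λ i → (i ∈? (C ∩ P δ)) →-dec (lookup t i Sign.≟ Sign.+))

  bad? : ∀ C → Dec (Bad δ C)
  bad? C = nonempty? (C ∩ P δ) ×-dec (sgnᶜ δ C Sign.≟ Sign.+)
           ×-dec ∃sign? (isBadOrientation? C)

  arrow? : ∀ C C′ → Dec (Arrow δ C C′)
  arrow? C C′ =
    isCycle? C ×-dec isCycle? C′ ×-dec ¬? (C ≟ˢ C′) ×-dec bad? C′ ×-dec
    ∃sign? λ t → isBadOrientation? C′ t ×-dec
      any? λ i → any? λ j →
        (i ∈? (C ∩ P δ)) ×-dec (j ∈? (C′ ∩ Z δ)) ×-dec (i <? j)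
        ×-dec (lookup t j Sign.≟ Sign.+)

  path? : ∀ C C′ → Dec (Star (Arrow δ) C C′)
  path? = Reachability.star? (Arrow δ) _≟ˢ_ arrow? (map (cycle δ) (allFin g))
    λ { (_ , (i , refl) , _) → ∈-map⁺ (cycle δ) (∈-allFin i) }

  condition*? : Dec (Condition* δ)
  condition*? = map′ to from
    (all? λ i → bad? (cycle δ i) →-dec
      any? λ j → ¬? (bad? (cycle δ j)) ×-dec path? (cycle δ j) (cycle δ i))
    where
    FromGood : Subset g → Set
    FromGood C = ∃ λ j → Good δ (cycle δ j) × Star (Arrow δ) (cycle δ j) C

    to : (∀ i → Bad δ (cycle δ i) → FromGood (cycle δ i)) → Condition* δ
    to h _ (i , refl) b with h i b
    ... | j , good , p = cycle δ j , (j , refl) , good , p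

    from : Condition* δ → ∀ i → Bad δ (cycle δ i) → FromGood (cycle δ i)
    from h i b with h (cycle δ i) (i , refl) b
    ... | _ , (j , refl) , good , p = j , good , p

------------------------------------------------------------------------

N : ℕ → ℕ
N g = length (filter condition*? (words g))

f : ℕ → ℤ
f g = + (2 ^ (g ∸ 1)) ℤ.- + N g

nonZero-g∸2 : ∀ {g} → 3 ≤ g → NonZero (g ∸ 2)
nonZero-g∸2 3≤g = >-nonZero (ℕ.m<n⇒0<n∸m 3≤g)

infix 4 _⟶_

_⟶_ : (ℕ → ℚᵘ) → ℚᵘ → Set
u ⟶ l = ∀ ε → 0ℚᵘ ℚᵘ.< ε → ∃ λ G → ∀ g → G ≤ g → ℚᵘ.∣ u g ℚᵘ.- l ∣ ℚᵘ.< ε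

{-# OPTIONS --safe #-}
-- Following π through the ones of a word until a zero is met identifies words with lists of
-- runs 1ˣ0, and both bounds compare failing words with lists having a longest run in front.
-- Lower bound: if the word read off such a list, with a final run 0 added, is δ, then the
-- cycle of the first point of δ consists of the first and last points and the ones of the
-- front run; it is bad and receives no arrow. Moving a longest run to the front is at most
-- n-to-one on the words of length n = g − 2.
-- Upper bound: if (∗) fails and δ₁ = 0, let D carry a longest run of ones, of length b, among
-- the cycles with a path to some unreached bad cycle. These are all bad, and a run longer
-- than b + 1 off D would start an arrow into D. So the letters along D and the runs off D
-- combine to a list of total length g + 2 whose front run is strictly longest; it determines
-- δ (Gessel–Reutenauer), and its g + 2 rotations are distinct nonconstant words.
module Submission where

open import Defs
open import Data.Integer using (+_; _-_)
open import Data.Nat using (ℕ; _+_; _∸_; _^_; _≤_)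
open import Data.Nat.Properties using (m^n≢0)
open import Data.Product using (_×_)
open import Data.Rational.Unnormalised using (_/_; 1ℚᵘ) renaming (_≤_ to _≤ᵘ_)

open import Data.Bool.Base using (Bool; true; false; not; _∧_; _∨_; if_then_else_)
import Data.Bool.Properties as Bool
open import Data.Bool.Properties using (∧-zeroʳ; ∨-zeroʳ; ∧-identityʳ)
open import Data.Empty using (⊥; ⊥-elim)
open import Data.Fin.Base using (Fin; zero; suc; toℕ; fromℕ)
open import Data.Fin.Permutation using (Permutation′; permutation)
import Data.Fin.Properties as Fin
open import Data.Fin.Properties using (toℕ-fromℕ<; toℕ-fromℕ; toℕ-injective; toℕ<n; pigeonhole; injective⇒existsPivot; any?; ¬∀⟶∃¬)
open import Data.Fin.Subset using (Subset; _∈_; _∉_; _∩_; ⋃; ⁅_⁆)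
open import Data.Fin.Subset.Properties using (_∈?_; ∉⊥; x∈⁅x⁆; x∈⁅y⁆⇒x≡y; x∈p∪q⁻; x∈p∪q⁺; x∈p∩q⁺; x∈p∩q⁻; x∉p⇒x∈∁p; x∈∁p⇒x∉p; ⊆-antisym)
open import Data.Integer using (-[1+_]; +≤+; +<+)
import Data.Integer as ℤ
import Data.Integer.Properties as ℤ
open import Data.List.Base using (List; []; _∷_; _++_; _∷ʳ_; map; length; replicate; take; drop; initLast; _∷ʳ′_; foldr; filter; tabulate; iterate; allFin; upTo; cartesianProduct)
open import Data.List.Membership.Propositional using () renaming (_∈_ to _∈ˡ_)
open import Data.List.Membership.Propositional.Properties using (∈-∃++; ∈-++⁻; ∈-++⁺ˡ; ∈-++⁺ʳ; ∈-map⁺; ∈-map⁻; ∈-upTo⁺; ∈-upTo⁻; ∈-allFin; ∈-filter⁺; ∈-filter⁻; ∈-cartesianProduct⁺; ∈-cartesianProduct⁻)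
open import Data.List.Properties using (length-++; length-map; length-replicate; length-take; length-drop; length-upTo; length-tabulate; length-iterate; take++drop≡id; take-all; take-take; map-++; filter-++; filter-none; ++-assoc; ++-identityʳ; ∷-injective; ∷-injectiveˡ; ∷-injectiveʳ; ∷ʳ-injectiveˡ; ∷ʳ-injectiveʳ)
open import Data.List.Relation.Unary.All as All using (All; []; _∷_)
import Data.List.Relation.Unary.All.Properties as All
open import Data.List.Relation.Unary.AllPairs using ([]; _∷_)
open import Data.List.Relation.Unary.Any using (here; there)
open import Data.List.Relation.Unary.Unique.Propositional using (Unique)
open import Data.List.Relation.Unary.Unique.Propositional.Properties using (Unique[x∷xs]⇒x∉xs; map⁺; ++⁺; upTo⁺; allFin⁺; filter⁺; cartesianProduct⁺; cartesianProductWith⁺)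
open import Data.Nat.Base using (zero; suc; pred; _*_; _⊓_; _<_; _<ᵇ_; z≤n; s≤s; s≤s⁻¹; NonZero)
open import Data.Nat.Properties
open import Data.Nat.Solver using (module +-*-Solver)
open import Data.Product.Base using (∃; ∃₂; _,_; proj₁; proj₂)
open import Data.Rational.Unnormalised using (mkℚᵘ; *≤*; *<*; ∣_∣) renaming (_<_ to _<ᵘ_; _-_ to _-ᵘ_)
open import Data.Sign.Base as Sign using (Sign)
import Data.Sign.Properties as Sign
open import Data.Sum.Base using (_⊎_; inj₁; inj₂; swap)
open import Data.Sum.Properties using (inj₁-injective; inj₂-injective)
open import Data.Unit.Base using (⊤; tt)
open import Data.Vec.Base as Vec using (Vec; []; _∷_; lookup; toList; _[_]≔_; here; there)
open import Data.Vec.Properties using ([]=⇒lookup; lookup⇒[]=; lookup∘update; lookup∘update′; lookup-replicate; tabulate∘lookup; tabulate-cong; length-toList)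
open import Function.Base using (_∘_; id)
open import Relation.Binary.Construct.Closure.ReflexiveTransitive using (Star; ε; _◅_)
open import Relation.Binary.Definitions using (tri<; tri≈; tri>)
open import Relation.Binary.PropositionalEquality
open import Relation.Nullary using (¬_; Dec; yes; no; does; contradiction; ¬?; _×-dec_; _→-dec_)
open import Relation.Nullary.Decidable using (decidable-stable)
import Algebra.Properties.CommutativeMonoid.Sum as CMSum

open CMSum Sign.*-commutativeMonoid using () renaming (sum to ∏; sum-permute to ∏-permute; ∑-distrib-+ to ∏-distrib; sum-cong-≗ to ∏-cong)
open CMSum +-0-commutativeMonoid using () renaming (sum to ∑; sum-permute to ∑-permute; sum-cong-≗ to ∑-cong)


-- Counting by injections, and words as lists of runs

-- All order arguments rest on three properties of `π δ`: it increases on ones, decreases on zeros,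
-- and puts every image of a one before every image of a zero. Hence the points with at least k ones
-- behind them form an initial segment. This makes points of different cycles comparable, as arrows
-- require: the zero that ends the longest run on D does not have b + 1 ones behind it, so any point
-- off D that has them lies before that zero. Only one cycle of a failing word is ever read
-- cyclically. Off an invariant set, `π δ` moves ranks by a rule that depends on the remaining word
-- alone, so that word can be coded by its order, with no decomposition into further cycles. The
-- additive constants come from exceptional words. In the lower bound, the word of zeros has no run
-- of ones to move, whence the 1. In the upper bound, the two constant words are not rotations of
-- any codeword, whence the 2. The shift in g - 2 is one zero that closes the last run and one added
-- final run.

length-≤ : {A B : Set} (_~_ : A → B → Set) {xs : List A} {ys : List B} → Unique xs →
           (∀ {x} → x ∈ˡ xs → ∃ λ y → y ∈ˡ ys × x ~ y) →
           (∀ {x x′ y} → x ~ y → x′ ~ y → x ≡ x′) →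
           length xs ≤ length ys
length-≤ _~_ {[]} u total inj = z≤n
length-≤ _~_ {x ∷ xs} {ys} u@(_ ∷ u′) total inj with total (here refl)
... | y , y∈ , x~y with ∈-∃++ y∈
... | as , bs , refl = begin
  suc (length xs)             ≤⟨ s≤s (length-≤ _~_ u′ total′ inj) ⟩
  suc (length (as ++ bs))     ≡⟨ cong suc (length-++ as) ⟩
  suc (length as + length bs) ≡⟨ +-suc (length as) (length bs) ⟨
  length as + suc (length bs) ≡⟨ length-++ as ⟨
  length (as ++ y ∷ bs)       ∎
  where
  open ≤-Reasoning
  total′ : ∀ {x′} → x′ ∈ˡ xs → ∃ λ z → z ∈ˡ (as ++ bs) × x′ ~ z
  total′ x′∈ with total (there x′∈)
  ... | z , z∈ , x′~z with ∈-++⁻ as z∈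
  ... | inj₁ z∈as         = z , ∈-++⁺ˡ z∈as , x′~z
  ... | inj₂ (there z∈bs) = z , ∈-++⁺ʳ as z∈bs , x′~z
  ... | inj₂ (here refl)  =
    contradiction (subst (_∈ˡ xs) (inj x′~z x~y) x′∈) (Unique[x∷xs]⇒x∉xs u)

-- Levi's lemma for two factorisations of a word, in the case where the left factor `v` is the
-- longer one.
++-split : {A : Set} (v v′ : List A) {u u′ : List A} → v ++ u ≡ v′ ++ u′ → length u ≤ length u′ →
           ∃ λ s → v ≡ v′ ++ s × u′ ≡ s ++ u
++-split v       []       eq   le = v , refl , sym eq
++-split []      (x ∷ v′) {u′ = u′} refl le =
  contradiction le (<⇒≱ (s≤s (≤-trans (m≤n+m (length u′) (length v′)) (≤-reflexive (sym (length-++ v′))))))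
++-split (y ∷ v) (x ∷ v′) eq   le with ∷-injective eq
... | refl , eq′ with ++-split v v′ eq′ le
... | s , refl , e = s , refl , e

++-injective : {A : Set} (v v′ : List A) {u u′ : List A} → v ++ u ≡ v′ ++ u′ → length v ≡ length v′ →
               v ≡ v′ × u ≡ u′
++-injective []      []       eq len = refl , eq
++-injective (x ∷ v) (y ∷ v′) eq len with ∷-injective eq
... | refl , eq′ with ++-injective v v′ eq′ (suc-injective len)
... | refl , e = refl , e

cols : List ℕ → List Bool
cols []       = []
cols (x ∷ xs) = replicate x true ++ false ∷ cols xs

total : List ℕ → ℕ
total []       = 0
total (x ∷ xs) = suc (x + total xs)

total-++ : ∀ xs {ys} → total (xs ++ ys) ≡ total xs + total ys
total-++ []       = refl
total-++ (x ∷ xs) {ys} = cong suc (trans (cong (_+_ x) (total-++ xs)) (sym (+-assoc x (total xs) (total ys))))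

length-cols : ∀ xs → length (cols xs) ≡ total xs
length-cols []       = refl
length-cols (x ∷ xs) = begin
  length (replicate x true ++ false ∷ cols xs)       ≡⟨ length-++ (replicate x true) ⟩
  length (replicate x true) + suc (length (cols xs)) ≡⟨ cong₂ _+_ (length-replicate x) (cong suc (length-cols xs)) ⟩
  x + suc (total xs)                                 ≡⟨ +-suc x (total xs) ⟩
  suc (x + total xs)                                 ∎
  where open ≡-Reasoning

cols-++ : ∀ xs {ys} → cols (xs ++ ys) ≡ cols xs ++ cols ys
cols-++ []       = refl
cols-++ (x ∷ xs) {ys} = begin
  replicate x true ++ false ∷ cols (xs ++ ys)          ≡⟨ cong (λ w → replicate x true ++ false ∷ w) (cols-++ xs) ⟩
  replicate x true ++ (false ∷ cols xs) ++ cols ys     ≡⟨ ++-assoc (replicate x true) _ _ ⟨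
  (replicate x true ++ false ∷ cols xs) ++ cols ys     ∎
  where open ≡-Reasoning

cols-injective : ∀ xs ys → cols xs ≡ cols ys → xs ≡ ys
cols-injective []         []          eq = refl
cols-injective []         (zero ∷ ys)   ()
cols-injective []         (suc y ∷ ys)  ()
cols-injective (zero ∷ xs)  (zero ∷ ys)   eq = cong (0 ∷_) (cols-injective xs ys (∷-injectiveʳ eq))
cols-injective (suc x ∷ xs) (suc y ∷ ys)  eq with cols-injective (x ∷ xs) (y ∷ ys) (∷-injectiveʳ eq)
... | refl = refl

cols-surjective : ∀ w → ∃₂ λ x xs → cols (x ∷ xs) ≡ w ∷ʳ false
cols-surjective []          = 0 , [] , refl
cols-surjective (true ∷ w)  with cols-surjective w
... | x , xs , eq = suc x , xs , cong (true ∷_) eq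
cols-surjective (false ∷ w) with cols-surjective w
... | x , xs , eq = 0 , x ∷ xs , cong (false ∷_) eq

cols-last : ∀ x xs → ∃ λ w → cols (x ∷ xs) ≡ w ∷ʳ false
cols-last x [] = replicate x true , refl
cols-last x (y ∷ xs) with cols-last y xs
... | w , eq = replicate x true ++ false ∷ w ,
  trans (cong (λ w → replicate x true ++ false ∷ w) eq) (sym (++-assoc (replicate x true) _ _))

-- A nonempty suffix of `cols l` still ends in `false`, and any word ending in `false` splits into
-- runs.
cols-suffix : ∀ q p l → q ++ p ≡ cols l → 0 < length p → ∃₂ λ x xs → cols (x ∷ xs) ≡ p
cols-suffix q p l eq p≢[] with initLast p
cols-suffix q .([]) l eq () | []
cols-suffix q .(p ∷ʳ c) [] eq p≢[] | p ∷ʳ′ c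
  with () ← trans (sym (cong length eq))
       (trans (length-++ q) (trans (cong (_+_ (length q)) (trans (length-++ p) (+-comm (length p) 1))) (+-suc (length q) _)))
cols-suffix q .(p ∷ʳ c) (x ∷ xs) eq p≢[] | p ∷ʳ′ c with cols-last x xs
... | w , e with ∷ʳ-injectiveʳ (q ++ p) w (trans (++-assoc q p _) (trans eq e))
... | refl = cols-surjective p

-- Rotations of words with a strictly longest front run

StrictFront : List ℕ → Set
StrictFront []       = ⊥
StrictFront (x ∷ xs) = All (_< x) xs

-- Each of `p` and `q` is a suffix of a word of runs, so both are words of runs themselves. The
-- front run of `p` would then exceed that of `q`, and conversely.
rotation-trivial : ∀ p q l l′ → StrictFront l → StrictFront l′ →
                   p ++ q ≡ cols l → q ++ p ≡ cols l′ → 0 < length p → ¬ 0 < length q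
rotation-trivial p q (B ∷ l) (B′ ∷ l′) front front′ eq eq′ 0<p 0<q
  with cols-suffix q p (B′ ∷ l′) eq′ 0<p | cols-suffix p q (B ∷ l) eq 0<q
... | x , xs , refl | y , ys , refl
  with cols-injective ((x ∷ xs) ++ y ∷ ys) (B ∷ l) (trans (cols-++ (x ∷ xs)) eq)
     | cols-injective ((y ∷ ys) ++ x ∷ xs) (B′ ∷ l′) (trans (cols-++ (y ∷ ys)) eq′)
... | refl | refl = <-asym (All.lookup front (∈-++⁺ʳ xs (here refl))) (All.lookup front′ (∈-++⁺ʳ ys (here refl)))

-- Nonemptiness of `v` keeps `i` below the length of `w`; the full rotation would repeat `i = 0`.
Rotation : ℕ → List Bool → List Bool → Set
Rotation i w x = ∃₂ λ u v → w ≡ u ++ v × x ≡ v ++ u × length u ≡ i × 0 < length v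

rotation-injective : ∀ {i i′ l l′ x} → StrictFront l → StrictFront l′ →
                     Rotation i (cols l) x → Rotation i′ (cols l′) x → i ≡ i′ × l ≡ l′
rotation-injective {l = l} {l′} front front′
  (u , v , eq , refl , refl , 0<v) (u′ , v′ , eq′ , e , refl , 0<v′)
  with <-cmp (length u) (length u′)
... | tri≈ _ len _ with ++-split v v′ e (≤-reflexive len)
...   | s ∷ ss , refl , refl = contradiction len (<⇒≢ (s≤s (≤-trans (m≤n+m _ (length ss)) (≤-reflexive (sym (length-++ ss))))))
...   | [] , refl , refl =
  refl , cols-injective l l′ (trans eq (trans (cong (u ++_) (++-identityʳ v′)) (sym eq′)))
rotation-injective {l = l} {l′} front front′
  (u , v , eq , refl , refl , 0<v) (u′ , v′ , eq′ , e , refl , 0<v′) | tri< lt _ _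
  with ++-split v v′ e (<⇒≤ lt)
... | [] , refl , refl = contradiction lt (<-irrefl refl)
... | s ∷ ss , refl , refl =
  contradiction (≤-trans 0<v′ (≤-trans (m≤n+m _ (length u)) (≤-reflexive (sym (length-++ u)))))
    (rotation-trivial (s ∷ ss) (u ++ v′) l′ l front′ front
      (sym (trans eq′ (++-assoc (s ∷ ss) u v′)))
      (trans (++-assoc u v′ (s ∷ ss)) (sym eq)) (s≤s z≤n))
rotation-injective {l = l} {l′} front front′
  (u , v , eq , refl , refl , 0<v) (u′ , v′ , eq′ , e , refl , 0<v′) | tri> _ _ lt
  with ++-split v′ v (sym e) (<⇒≤ lt)
... | [] , refl , refl = contradiction lt (<-irrefl refl)
... | s ∷ ss , refl , refl =
  contradiction (≤-trans 0<v (≤-trans (m≤n+m _ (length u′)) (≤-reflexive (sym (length-++ u′)))))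
    (rotation-trivial (s ∷ ss) (u′ ++ v) l l′ front front′
      (sym (trans eq (++-assoc (s ∷ ss) u′ v)))
      (trans (++-assoc u′ v (s ∷ ss)) (sym eq′)) (s≤s z≤n))

-- The word built from a list of runs

ones : List Bool → ℕ
ones []          = 0
ones (true ∷ w)  = suc (ones w)
ones (false ∷ w) = ones w

ones-++ : ∀ u {v} → ones (u ++ v) ≡ ones u + ones v
ones-++ []          = refl
ones-++ (true ∷ u)  = cong suc (ones-++ u)
ones-++ (false ∷ u) = ones-++ u

ones≤length : ∀ w → ones w ≤ length w
ones≤length []          = z≤n
ones≤length (true ∷ w)  = s≤s (ones≤length w)
ones≤length (false ∷ w) = m≤n⇒m≤1+n (ones≤length w)

pos : ℕ → Bool
pos zero    = false
pos (suc _) = true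

dec : List ℕ → List ℕ
dec []           = []
dec (zero ∷ xs)  = dec xs
dec (suc x ∷ xs) = x ∷ dec xs

-- The points of build k a without a one behind them under π start orbit segments
-- which read 1ˣ0 for the successive entries x of a (k only bounds these entries).
build : ℕ → List ℕ → List Bool
build zero    a = map (λ _ → false) a
build (suc k) a = build k (dec a) ++ map pos a

dec-All : ∀ {k a} → All (_≤ suc k) a → All (_≤ k) (dec a)
dec-All []                  = []
dec-All {a = zero ∷ _}  (_ ∷ h)     = dec-All h
dec-All {a = suc _ ∷ _} (s≤s p ∷ h) = p ∷ dec-All h

total-dec : ∀ a → total (dec a) + length a ≡ total a
total-dec []           = refl
total-dec (zero ∷ a)   = trans (+-suc _ _) (cong suc (total-dec a))
total-dec (suc x ∷ a)  = cong suc (begin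
  x + total (dec a) + suc (length a)   ≡⟨ +-suc _ _ ⟩
  suc (x + total (dec a) + length a)   ≡⟨ cong suc (+-assoc x _ _) ⟩
  suc (x + (total (dec a) + length a)) ≡⟨ cong (λ n → suc (x + n)) (total-dec a) ⟩
  suc (x + total a)                    ∎)
  where open ≡-Reasoning

length-build : ∀ k {a} → All (_≤ k) a → length (build k a) ≡ total a
length-build zero    []        = refl
length-build zero    (z≤n ∷ h) = cong suc (length-build zero h)
length-build (suc k) {a} h     = begin
  length (build k (dec a) ++ map pos a)          ≡⟨ length-++ (build k (dec a)) ⟩
  length (build k (dec a)) + length (map pos a)  ≡⟨ cong₂ _+_ (length-build k (dec-All h)) (length-map pos a) ⟩
  total (dec a) + length a                       ≡⟨ total-dec a ⟩
  total a                                        ∎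
  where open ≡-Reasoning

ones-pos : ∀ a → ones (map pos a) ≡ length (dec a)
ones-pos []          = refl
ones-pos (zero ∷ a)  = ones-pos a
ones-pos (suc _ ∷ a) = cong suc (ones-pos a)

ones-false : ∀ (a : List ℕ) n → ones (take n (map (λ _ → false) a)) ≡ 0
ones-false []      zero    = refl
ones-false []      (suc n) = refl
ones-false (_ ∷ a) zero    = refl
ones-false (_ ∷ a) (suc n) = ones-false a n

build-zeros : ∀ k a → ones (build k a) + length a ≡ length (build k a)
-- So the left part of `build (suc k) a` is the prefix whose length is the number of ones, that is,
-- the image of the ones under `π`. The word can therefore be cut at this place without knowing `a`.
ones-build : ∀ k a → ones (build (suc k) a) ≡ length (build k (dec a))

build-zeros zero    []      = refl
build-zeros zero    (x ∷ a) = trans (+-suc _ _) (cong suc (build-zeros zero a))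
build-zeros (suc k) a       = begin
  ones (build (suc k) a) + length a              ≡⟨ cong₂ _+_ (ones-build k a) (sym (length-map pos a)) ⟩
  length (build k (dec a)) + length (map pos a)  ≡⟨ length-++ (build k (dec a)) ⟨
  length (build (suc k) a)                       ∎
  where open ≡-Reasoning

ones-build k a = begin
  ones (build k (dec a) ++ map pos a)          ≡⟨ ones-++ (build k (dec a)) ⟩
  ones (build k (dec a)) + ones (map pos a)    ≡⟨ cong (_+_ (ones (build k (dec a)))) (ones-pos a) ⟩
  ones (build k (dec a)) + length (dec a)      ≡⟨ build-zeros k (dec a) ⟩
  length (build k (dec a))                     ∎
  where open ≡-Reasoning

pos-dec-injective : ∀ {a b} → map pos a ≡ map pos b → dec a ≡ dec b → a ≡ b
pos-dec-injective {[]}        {[]}        p d = refl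
pos-dec-injective {zero ∷ a}  {zero ∷ b}  p d = cong (0 ∷_) (pos-dec-injective (∷-injectiveʳ p) d)
pos-dec-injective {zero ∷ a}  {suc y ∷ b} () d
pos-dec-injective {suc x ∷ a} {zero ∷ b}  () d
pos-dec-injective {suc x ∷ a} {suc y ∷ b} p d =
  cong₂ _∷_ (cong suc (∷-injectiveˡ d)) (pos-dec-injective (∷-injectiveʳ p) (∷-injectiveʳ d))

build-injective : ∀ k {a b} → All (_≤ k) a → All (_≤ k) b → build k a ≡ build k b → a ≡ b
build-injective zero    []        []        eq = refl
build-injective zero    (z≤n ∷ h) (z≤n ∷ j) eq = cong (0 ∷_) (build-injective zero h j (∷-injectiveʳ eq))
build-injective (suc k) {a} {b} h j eq
  with ++-injective (build k (dec a)) (build k (dec b)) eq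
         (trans (sym (ones-build k a)) (trans (cong ones eq) (ones-build k b)))
... | eq₁ , eq₂ = pos-dec-injective eq₂ (build-injective k (dec-All h) (dec-All j) eq₁)

-- height w k counts the points of w with at least k consecutive ones behind them under π;
-- they form an initial segment, and π sends a one at position height w k to height w (suc k).
height : List Bool → ℕ → ℕ
height w zero    = length w
height w (suc k) = ones (take (height w k) w)

take-ones : ∀ n (w : List Bool) → ones (take n w) ≤ ones w
take-ones zero    w           = z≤n
take-ones (suc n) []          = z≤n
take-ones (suc n) (true ∷ w)  = s≤s (take-ones n w)
take-ones (suc n) (false ∷ w) = take-ones n w

height₁ : ∀ w → height w 1 ≡ ones w
height₁ w = cong ones (take-all (length w) w ≤-refl)

-- Passing to the image of the ones takes one step off every run, so heights shift by one; on lists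
-- of runs the same passage is `dec`.
height-take : ∀ w k → height (take (ones w) w) k ≡ height w (suc k)
height-take w zero    = trans (length-take (ones w) w) (trans (m≤n⇒m⊓n≡m (ones≤length w)) (sym (height₁ w)))
height-take w (suc k) = cong ones (begin
  take (height (take (ones w) w) k) (take (ones w) w) ≡⟨ cong (λ n → take n (take (ones w) w)) (height-take w k) ⟩
  take (height w (suc k)) (take (ones w) w)           ≡⟨ take-take (height w (suc k)) (ones w) w ⟩
  take (height w (suc k) ⊓ ones w) w    ≡⟨ cong (λ n → take n w) (m≤n⇒m⊓n≡m (take-ones (height w k) w)) ⟩
  take (height w (suc k)) w                           ∎)
  where open ≡-Reasoning

pos-dec-surjective : ∀ {k} s {a} → All (_≤ k) a → length a ≡ ones s →
                     ∃ λ b → All (_≤ suc k) b × map pos b ≡ s × dec b ≡ a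
pos-dec-surjective []          {[]}    []      len = [] , [] , refl , refl
pos-dec-surjective (false ∷ s) {a}     h       len with pos-dec-surjective s h len
... | b , h′ , refl , refl = 0 ∷ b , z≤n ∷ h′ , refl , refl
pos-dec-surjective (true ∷ s)  {x ∷ a} (p ∷ h) len with pos-dec-surjective s h (suc-injective len)
... | b , h′ , refl , refl = suc x ∷ b , s≤s p ∷ h′ , refl , refl

-- The hypothesis says that no point has `suc k` ones behind it, so runs have length at most `k`.
-- The list is recovered by recursion on the image of the ones: the letters after that prefix tell
-- which entries are positive.
build-surjective : ∀ k w → height w (suc k) ≡ 0 → ∃ λ a → All (_≤ k) a × build k a ≡ w
build-surjective zero w h = go w (trans (sym (height₁ w)) h)
  where
  go : ∀ w → ones w ≡ 0 → ∃ λ a → All (_≤ 0) a × build 0 a ≡ w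
  go []          _ = [] , [] , refl
  go (false ∷ w) e with go w e
  ... | a , h , eq = 0 ∷ a , z≤n ∷ h , cong (false ∷_) eq
build-surjective (suc k) w h
  with build-surjective k (take (ones w) w) (trans (height-take w (suc k)) h)
... | a , a≤ , eq with pos-dec-surjective (drop (ones w) w) a≤ length-a
  where
  open ≡-Reasoning
  w₁ = take (ones w) w
  length-a : length a ≡ ones (drop (ones w) w)
  length-a = +-cancelˡ-≡ (ones w₁) _ _ (begin
    ones w₁ + length a                    ≡⟨ cong (λ u → ones u + length a) eq ⟨
    ones (build k a) + length a           ≡⟨ build-zeros k a ⟩
    length (build k a)                    ≡⟨ cong length eq ⟩
    height w₁ 0                           ≡⟨ trans (height-take w 0) (height₁ w) ⟩
    ones w                                ≡⟨ cong ones (take++drop≡id (ones w) w) ⟨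
    ones (w₁ ++ drop (ones w) w)          ≡⟨ ones-++ w₁ ⟩
    ones w₁ + ones (drop (ones w) w)      ∎)
... | b , b≤ , eq₂ , refl = b , b≤ , trans (cong₂ _++_ eq eq₂) (take++drop≡id (ones w) w)

-- The points at positions `height w 1`, `height w 2`, ... follow each other under `π`, and they
-- carry ones until position 0 is met.
Chain : List Bool → Set
Chain w = ∀ k → height w (suc k) ≡ 0 ⊎ ∃ λ s → drop (height w (suc k)) w ≡ true ∷ s

height-0 : ∀ w → ones w ≡ 0 → ∀ k → height w (suc k) ≡ 0
height-0 w e k = n≤0⇒n≡0 (≤-trans (take-ones (height w k) w) (≤-reflexive e))

drop-++-cons : ∀ {A : Set} n (u : List A) {v x s} → drop n u ≡ x ∷ s → drop n (u ++ v) ≡ x ∷ s ++ v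
drop-++-cons zero    (_ ∷ u) refl = refl
drop-++-cons (suc n) (_ ∷ u) eq   = drop-++-cons n u eq

drop-length : ∀ {A : Set} (u : List A) {v} → drop (length u) (u ++ v) ≡ v
drop-length []      = refl
drop-length (_ ∷ u) = drop-length u

take-length : ∀ {A : Set} (u : List A) {v} → take (length u) (u ++ v) ≡ u
take-length []      = refl
take-length (_ ∷ u) = cong (_ ∷_) (take-length u)

dec-zeros : ∀ {a} → All (_≤ 0) a → dec a ≡ []
dec-zeros []        = refl
dec-zeros (z≤n ∷ h) = dec-zeros h

build-[] : ∀ k → build k [] ≡ []
build-[] zero    = refl
build-[] (suc k) = cong (_++ []) (build-[] k)

-- The last block starts at position `height w 1`, and its first letter is `pos` of the front entry.
-- A maximal front entry stays in front under `dec`, so the same holds in each shorter prefix until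
-- all entries are used up.
build-chain : ∀ k {m a} → m ≤ k → All (_≤ m) a → Chain (build k (m ∷ a))
build-chain zero    {m} {a} m≤k h j = inj₁ (ones-false (m ∷ a) (height (build zero (m ∷ a)) j))
build-chain (suc k) {zero}  {a} m≤k h =
  λ j → inj₁ (height-0 (build (suc k) (0 ∷ a))
    (trans (ones-build k (0 ∷ a)) (cong length (trans (cong (build k) (dec-zeros h)) (build-[] k)))) j)
build-chain (suc k) {suc m} {a} (s≤s m≤k) h = go
  where
  open ≡-Reasoning
  w₁ = build k (m ∷ dec a)
  w  = build (suc k) (suc m ∷ a)
  w₁-prefix : take (ones w) w ≡ w₁
  w₁-prefix = trans (cong (λ n → take n w) (ones-build k (suc m ∷ a))) (take-length w₁)
  go : Chain w
  go zero = inj₂ (map pos a , trans (cong (λ n → drop n w) (trans (height₁ w) (ones-build k (suc m ∷ a)))) (drop-length w₁))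
  go (suc j) with build-chain k m≤k (dec-All h) j
  ... | inj₁ e = inj₁ (trans (sym (height-take w (suc j))) (trans (cong (λ u → height u (suc j)) w₁-prefix) e))
  ... | inj₂ (s , e) = inj₂ (s ++ map pos (suc m ∷ a) , trans
    (cong (λ n → drop n w) (trans (sym (height-take w (suc j))) (cong (λ u → height u (suc j)) w₁-prefix)))
    (drop-++-cons (height w₁ (suc j)) w₁ e))

-- When a maximal front entry is used up, so are all others; the innermost nonempty block is then
-- all zeros and opens the word.
build-head : ∀ k {m a} → m ≤ k → All (_≤ m) a → ∃ λ s → build k (m ∷ a) ≡ false ∷ s
build-head zero    {m}     m≤k h = _ , refl
build-head (suc k) {zero}  {a} m≤k h =
  _ , cong (_++ (false ∷ map pos a)) (trans (cong (build k) (dec-zeros h)) (build-[] k))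
build-head (suc k) {suc m} (s≤s m≤k) h with build-head k m≤k (dec-All h)
... | s , e = _ , cong (_++ _) e

-- The permutation π and its cycles


least : {Q : ℕ → Set} → (∀ n → Dec (Q n)) → ∀ {n} → Q n →
        ∃ λ m → m ≤ n × Q m × (∀ k → k < m → ¬ Q k)
least Q? {zero}  q = 0 , z≤n , q , λ _ ()
least Q? {suc n} q with Q? 0
... | yes q₀ = 0 , z≤n , q₀ , λ _ ()
... | no ¬q₀ with least (Q? ∘ suc) {n} q
... | m , m≤n , qm , min = suc m , s≤s m≤n , qm , λ { zero _ → ¬q₀ ; (suc k) (s≤s k<m) → min k k<m }

infixr 8 _^^_

_^^_ : {A : Set} → (A → A) → ℕ → A → A
(f ^^ zero)  x = x
(f ^^ suc n) x = f ((f ^^ n) x)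

^^-shift : {A : Set} (f : A → A) → ∀ n x → (f ^^ n) (f x) ≡ f ((f ^^ n) x)
^^-shift f zero    x = refl
^^-shift f (suc n) x = cong f (^^-shift f n x)

^^-+ : {A : Set} (f : A → A) → ∀ m n x → (f ^^ (m + n)) x ≡ (f ^^ m) ((f ^^ n) x)
^^-+ f zero    n x = refl
^^-+ f (suc m) n x = cong f (^^-+ f m n x)

^^-period-* : {A : Set} (f : A → A) → ∀ {N x} → (f ^^ N) x ≡ x → ∀ m → (f ^^ (m * N)) x ≡ x
^^-period-* f         e zero    = refl
^^-period-* f {N} {x} e (suc m) = trans (^^-+ f N (m * N) x) (trans (cong (f ^^ N) (^^-period-* f e m)) e)

^^-reduce : {A : Set} (f : A → A) → ∀ {N x} → (f ^^ suc N) x ≡ x →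
            ∀ n → ∃ λ k → k < suc N × (f ^^ n) x ≡ (f ^^ k) x
^^-reduce f e zero    = 0 , s≤s z≤n , refl
^^-reduce f {N} e (suc n) with ^^-reduce f e n
... | k , k< , eq with m≤n⇒m<n∨m≡n k<
... | inj₁ sk<  = suc k , sk< , cong f eq
... | inj₂ refl = 0 , s≤s z≤n , trans (cong f eq) e

∈-iterate⁻ : {A : Set} (f : A → A) → ∀ n {x y} → y ∈ˡ iterate f x n → ∃ λ k → k < n × y ≡ (f ^^ k) x
∈-iterate⁻ f (suc n) (here refl) = 0 , s≤s z≤n , refl
∈-iterate⁻ f (suc n) {x} (there y∈) with ∈-iterate⁻ f n y∈
... | k , k<n , eq = suc k , s≤s k<n , trans eq (^^-shift f k x)

∈-iterate⁺ : {A : Set} (f : A → A) → ∀ {n} x {k} → k < n → (f ^^ k) x ∈ˡ iterate f x n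
∈-iterate⁺ f x {zero}  (s≤s _)   = here refl
∈-iterate⁺ f {suc n} x {suc k} (s≤s k<n) =
  there (subst (_∈ˡ iterate f (f x) n) (^^-shift f k x) (∈-iterate⁺ f (f x) k<n))

module Orbit {g : ℕ} (f : Fin g → Fin g) (f-injective : ∀ {x y} → f x ≡ f y → x ≡ y) where

  ^^-injective : ∀ n {x y} → (f ^^ n) x ≡ (f ^^ n) y → x ≡ y
  ^^-injective zero    e = e
  ^^-injective (suc n) e = ^^-injective n (f-injective e)

  ^^-cancel : ∀ {m n x} → m < n → (f ^^ m) x ≡ (f ^^ n) x → (f ^^ (n ∸ m)) x ≡ x
  ^^-cancel {m} {n} {x} m<n e = sym (^^-injective m (begin
    (f ^^ m) x                   ≡⟨ e ⟩
    (f ^^ n) x                   ≡⟨ cong (λ k → (f ^^ k) x) (m+[n∸m]≡n (<⇒≤ m<n)) ⟨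
    (f ^^ (m + (n ∸ m))) x       ≡⟨ ^^-+ f m (n ∸ m) x ⟩
    (f ^^ m) ((f ^^ (n ∸ m)) x)  ∎))
    where open ≡-Reasoning

  period : ∀ x → ∃ λ N → suc N ≤ g × (f ^^ suc N) x ≡ x
  period x with pigeonhole (n<1+n g) (λ k → (f ^^ toℕ k) x)
  ... | i , j , i<j , e with toℕ j ∸ toℕ i in eq | ^^-cancel i<j e
  ... | zero  | _  = contradiction (m∸n≡0⇒m≤n eq) (<⇒≱ i<j)
  ... | suc N | e′ = N , ≤-trans (≤-reflexive (sym eq)) (≤-trans (m∸n≤m (toℕ j) (toℕ i)) (s≤s⁻¹ (toℕ<n j))) , e′

  min-period : ∀ x → ∃ λ N → suc N ≤ g × (f ^^ suc N) x ≡ x ×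
               (∀ {m n} → m < suc N → n < suc N → (f ^^ m) x ≡ (f ^^ n) x → m ≡ n)
  min-period x with period x
  ... | N , N<g , e with least (λ n → (f ^^ suc n) x Fin.≟ x) e
  ... | M , M≤N , eM , min = M , ≤-trans (s≤s M≤N) N<g , eM , inj
    where
    no-return : ∀ {m n} → m < n → n < suc M → (f ^^ m) x ≢ (f ^^ n) x
    no-return {m} {n} m<n n≤M e with n ∸ m in eq | ^^-cancel m<n e
    ... | zero  | _  = <⇒≱ m<n (m∸n≡0⇒m≤n eq)
    ... | suc k | e′ = min k (≤-trans (≤-reflexive (sym eq)) (≤-trans (m∸n≤m n m) (≤-pred n≤M))) e′
    inj : ∀ {m n} → m < suc M → n < suc M → (f ^^ m) x ≡ (f ^^ n) x → m ≡ n
    inj {m} {n} m≤ n≤ e with <-cmp m n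
    ... | tri< lt _ _ = contradiction e (no-return lt n≤)
    ... | tri≈ _ eq _ = eq
    ... | tri> _ _ lt = contradiction (sym e) (no-return lt m≤)

  f⁻¹ : Fin g → Fin g
  f⁻¹ x = (f ^^ proj₁ (period x)) x

  f∘f⁻¹ : ∀ x → f (f⁻¹ x) ≡ x
  f∘f⁻¹ x = proj₂ (proj₂ (period x))

  perm : Permutation′ g
  perm = permutation f f⁻¹ f∘f⁻¹ (λ x → f-injective (f∘f⁻¹ (f x)))

  back : ∀ n {x y} → (f ^^ n) x ≡ y → ∃ λ m → (f ^^ m) y ≡ x
  back n {x} refl with period x
  ... | N , _ , e with ^^-reduce f {N} e n
  ... | k , k< , eq = suc N ∸ k , (begin
    (f ^^ (suc N ∸ k)) ((f ^^ n) x) ≡⟨ cong (f ^^ (suc N ∸ k)) eq ⟩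
    (f ^^ (suc N ∸ k)) ((f ^^ k) x) ≡⟨ ^^-+ f (suc N ∸ k) k x ⟨
    (f ^^ (suc N ∸ k + k)) x        ≡⟨ cong (λ m → (f ^^ m) x) (m∸n+n≡m (<⇒≤ k<)) ⟩
    (f ^^ suc N) x                  ≡⟨ e ⟩
    x                               ∎)
    where open ≡-Reasoning

-- The order properties of the permutation

φ-step : ∀ {g} (δ : Word g) {i j} → toℕ i < toℕ j → φ δ i + bit (lookup δ j) ≤ φ δ j
φ-step (b ∷ δ) {zero} {suc j} _ = +-monoʳ-≤ (bit b) (go δ j)
  where
  go : ∀ {n} (δ : Word n) j → bit (lookup δ j) ≤ φ δ j
  go (b ∷ δ) zero    = ≤-refl
  go (b ∷ δ) (suc j) = ≤-trans (go δ j) (m≤n+m _ (bit b))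
φ-step (b ∷ δ) {suc i} {suc j} (s≤s i<j) =
  ≤-trans (≤-reflexive (+-assoc (bit b) (φ δ i) _)) (+-monoʳ-≤ (bit b) (φ-step δ i<j))

bit≤1 : ∀ b → bit b ≤ 1
bit≤1 true  = s≤s z≤n
bit≤1 false = z≤n

φ≤ : ∀ {g} (δ : Word g) i → φ δ i ≤ suc (toℕ i)
φ≤ (b ∷ δ) zero    = bit≤1 b
φ≤ (b ∷ δ) (suc i) = +-mono-≤ (bit≤1 b) (φ≤ δ i)

ζ : ∀ {g} → Word g → Fin g → ℕ
ζ (b ∷ δ) zero    = bit (not b)
ζ (b ∷ δ) (suc i) = bit (not b) + ζ δ i

φ+ζ : ∀ {g} (δ : Word g) i → φ δ i + ζ δ i ≡ suc (toℕ i)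
φ+ζ (true ∷ δ)  zero    = refl
φ+ζ (false ∷ δ) zero    = refl
φ+ζ (true ∷ δ)  (suc i) = cong suc (φ+ζ δ i)
φ+ζ (false ∷ δ) (suc i) = trans (+-suc _ _) (cong suc (φ+ζ δ i))

ζ-step : ∀ {g} (δ : Word g) {i j} → toℕ i < toℕ j → ζ δ i + bit (not (lookup δ j)) ≤ ζ δ j
ζ-step (b ∷ δ) {zero} {suc j} _ = +-monoʳ-≤ (bit (not b)) (go δ j)
  where
  go : ∀ {n} (δ : Word n) j → bit (not (lookup δ j)) ≤ ζ δ j
  go (b ∷ δ) zero    = ≤-refl
  go (b ∷ δ) (suc j) = ≤-trans (go δ j) (m≤n+m _ (bit (not b)))
ζ-step (b ∷ δ) {suc i} {suc j} (s≤s i<j) =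
  ≤-trans (≤-reflexive (+-assoc (bit (not b)) (ζ δ i) _)) (+-monoʳ-≤ (bit (not b)) (ζ-step δ i<j))

π-one : ∀ {g} (δ : Word g) i → lookup δ i ≡ true → toℕ (π δ i) ≡ pred (φ δ i)
π-one {g} δ i e = trans (toℕ-fromℕ< _) (cong (λ b → pred (if b then φ δ i else g ∸ (suc (toℕ i) ∸ φ δ i) + 1)) e)

π-zero : ∀ {g} (δ : Word g) i → lookup δ i ≡ false → toℕ (π δ i) ≡ g ∸ ζ δ i
π-zero {g} δ i e = begin
  toℕ (π δ i)                                ≡⟨ toℕ-fromℕ< _ ⟩
  pred (π₁ δ i)                              ≡⟨ cong (λ b → pred (if b then φ δ i else g ∸ (suc (toℕ i) ∸ φ δ i) + 1)) e ⟩
  pred (g ∸ (suc (toℕ i) ∸ φ δ i) + 1)       ≡⟨ cong pred (+-comm (g ∸ (suc (toℕ i) ∸ φ δ i)) 1) ⟩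
  g ∸ (suc (toℕ i) ∸ φ δ i)                  ≡⟨ cong (λ n → g ∸ (n ∸ φ δ i)) (φ+ζ δ i) ⟨
  g ∸ (φ δ i + ζ δ i ∸ φ δ i)                ≡⟨ cong (g ∸_) (m+n∸m≡n (φ δ i) (ζ δ i)) ⟩
  g ∸ ζ δ i                                  ∎
  where open ≡-Reasoning

1≤φ : ∀ {g} (δ : Word g) {i} → lookup δ i ≡ true → 1 ≤ φ δ i
1≤φ (true ∷ δ) {zero}  refl = s≤s z≤n
1≤φ (b ∷ δ)    {suc i} e    = ≤-trans (1≤φ δ e) (m≤n+m _ (bit b))

ζ≤g : ∀ {g} (δ : Word g) i → ζ δ i ≤ g
ζ≤g δ i = ≤-trans (m≤n+m _ (φ δ i)) (≤-trans (≤-reflexive (φ+ζ δ i)) (toℕ<n i))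

π-one-mono : ∀ {g} (δ : Word g) {i j} → lookup δ i ≡ true → lookup δ j ≡ true →
             toℕ i < toℕ j → toℕ (π δ i) < toℕ (π δ j)
π-one-mono δ {i} {j} ei ej i<j
  rewrite π-one δ i ei | π-one δ j ej with φ δ i | 1≤φ δ ei | φ-step δ {i} {j} i<j
... | suc a | _ | le rewrite ej =
  pred-mono-≤ {suc (suc a)} (≤-trans (≤-reflexive (+-comm 1 (suc a))) le)

π-zero-anti : ∀ {g} (δ : Word g) {i j} → lookup δ i ≡ false → lookup δ j ≡ false →
              toℕ i < toℕ j → toℕ (π δ j) < toℕ (π δ i)
π-zero-anti δ {i} {j} ei ej i<j
  rewrite π-zero δ i ei | π-zero δ j ej with ζ-step δ {i} {j} i<j
... | le rewrite ej = ∸-monoʳ-< (≤-trans (≤-reflexive (+-comm 1 (ζ δ i))) le) (ζ≤g δ j)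

π-one-zero : ∀ {g} (δ : Word g) {i j} → lookup δ i ≡ true → lookup δ j ≡ false →
             toℕ (π δ i) < toℕ (π δ j)
π-one-zero {g} δ {i} {j} ei ej
  rewrite π-one δ i ei | π-zero δ j ej = m+n≤o⇒m≤o∸n _ (≤-trans (≤-reflexive (cong (_+ ζ δ j) suc-pred-φ)) sum≤)
  where
  suc-pred-φ : suc (pred (φ δ i)) ≡ φ δ i
  suc-pred-φ with φ δ i | 1≤φ δ ei
  ... | suc _ | _ = refl
  mono : {h : Fin g → ℕ} {e : Fin g → ℕ} → (∀ {i j} → toℕ i < toℕ j → h i + e j ≤ h j) →
         ∀ {i j} → toℕ i ≤ toℕ j → h i ≤ h j
  mono {h} step i≤j with m≤n⇒m<n∨m≡n i≤j
  ... | inj₁ i<j = ≤-trans (m≤m+n _ _) (step i<j)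
  ... | inj₂ i≡j = ≤-reflexive (cong h (toℕ-injective i≡j))
  -- Both counts grow with the point, and at the later of `i` and `j` they add up to its one-based
  -- position.
  sum≤ : φ δ i + ζ δ j ≤ g
  sum≤ with ≤-total (toℕ i) (toℕ j)
  ... | inj₁ i≤j = ≤-trans (+-monoˡ-≤ (ζ δ j) (mono {φ δ} (φ-step δ) i≤j)) (≤-trans (≤-reflexive (φ+ζ δ j)) (toℕ<n j))
  ... | inj₂ j≤i = ≤-trans (+-monoʳ-≤ (φ δ i) (mono {ζ δ} (ζ-step δ) j≤i)) (≤-trans (≤-reflexive (φ+ζ δ i)) (toℕ<n i))

true⊎false : ∀ b → b ≡ true ⊎ b ≡ false
true⊎false true  = inj₁ refl
true⊎false false = inj₂ refl

π-apart : ∀ {g} (δ : Word g) {i j} → toℕ i < toℕ j → π δ i ≢ π δ j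
π-apart δ {i} {j} i<j e with true⊎false (lookup δ i) | true⊎false (lookup δ j)
... | inj₁ ei | inj₁ ej = <-irrefl (cong toℕ e) (π-one-mono δ ei ej i<j)
... | inj₁ ei | inj₂ ej = <-irrefl (cong toℕ e) (π-one-zero δ ei ej)
... | inj₂ ei | inj₁ ej = <-irrefl (cong toℕ (sym e)) (π-one-zero δ ej ei)
... | inj₂ ei | inj₂ ej = <-irrefl (cong toℕ (sym e)) (π-zero-anti δ ei ej i<j)

π-injective : ∀ {g} (δ : Word g) {i j} → π δ i ≡ π δ j → i ≡ j
π-injective δ {i} {j} e with <-cmp (toℕ i) (toℕ j)
... | tri< lt _ _ = contradiction e (π-apart δ lt)
... | tri≈ _ eq _ = toℕ-injective eq
... | tri> _ _ lt = contradiction (sym e) (π-apart δ lt)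

module πOrbit {g : ℕ} (δ : Word g) = Orbit (π δ) (π-injective δ)

-- Cycles as sets, and their signs

∈-⋃⁻ : ∀ {g} (xs : List (Fin g)) {x} → x ∈ ⋃ (map ⁅_⁆ xs) → x ∈ˡ xs
∈-⋃⁻ []       x∈ = contradiction x∈ ∉⊥
∈-⋃⁻ (y ∷ xs) x∈ with x∈p∪q⁻ ⁅ y ⁆ _ x∈
... | inj₁ x∈y  = here (x∈⁅y⁆⇒x≡y y x∈y)
... | inj₂ x∈xs = there (∈-⋃⁻ xs x∈xs)

∈-⋃⁺ : ∀ {g} {xs : List (Fin g)} {x} → x ∈ˡ xs → x ∈ ⋃ (map ⁅_⁆ xs)
∈-⋃⁺ (here refl) = x∈p∪q⁺ (inj₁ (x∈⁅x⁆ _))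
∈-⋃⁺ (there x∈)  = x∈p∪q⁺ (inj₂ (∈-⋃⁺ x∈))

∈-cycle⁻ : ∀ {g} (δ : Word g) {i j} → j ∈ cycle δ i → ∃ λ n → j ≡ (π δ ^^ n) i
∈-cycle⁻ {g} δ {i} j∈ with ∈-iterate⁻ (π δ) g (∈-⋃⁻ (iterate (π δ) i g) j∈)
... | n , _ , eq = n , eq

∈-cycle⁺ : ∀ {g} (δ : Word g) i n → (π δ ^^ n) i ∈ cycle δ i
∈-cycle⁺ {g} δ i n with πOrbit.period δ i
... | N , N<g , e with ^^-reduce (π δ) {N} e n
... | k , k< , eq = subst (_∈ cycle δ i) (sym eq) (∈-⋃⁺ (∈-iterate⁺ (π δ) i (<-≤-trans k< N<g)))

∈-cycle-self : ∀ {g} (δ : Word g) i → i ∈ cycle δ i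
∈-cycle-self δ i = ∈-cycle⁺ δ i 0

∈-cycle-π : ∀ {g} (δ : Word g) {i j} → j ∈ cycle δ i → π δ j ∈ cycle δ i
∈-cycle-π δ {i} j∈ with ∈-cycle⁻ δ j∈
... | n , refl = ∈-cycle⁺ δ i (suc n)

∈-cycle-trans : ∀ {g} (δ : Word g) {i j k} → k ∈ cycle δ j → j ∈ cycle δ i → k ∈ cycle δ i
∈-cycle-trans δ {i} k∈ j∈ with ∈-cycle⁻ δ k∈ | ∈-cycle⁻ δ j∈
... | m , refl | n , refl = subst (_∈ cycle δ i) (^^-+ (π δ) m n i) (∈-cycle⁺ δ i (m + n))

∈-cycle-sym : ∀ {g} (δ : Word g) {i j} → j ∈ cycle δ i → i ∈ cycle δ j
∈-cycle-sym δ {i} {j} j∈ with ∈-cycle⁻ δ j∈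
... | n , e with πOrbit.back δ n (sym e)
... | m , eq = subst (_∈ cycle δ j) eq (∈-cycle⁺ δ j m)

cycle-≡ : ∀ {g} (δ : Word g) {i j} → j ∈ cycle δ i → cycle δ j ≡ cycle δ i
cycle-≡ δ j∈ = ⊆-antisym (λ k∈ → ∈-cycle-trans δ k∈ j∈) (λ k∈ → ∈-cycle-trans δ k∈ (∈-cycle-sym δ j∈))

∈-cycle-π⁻ : ∀ {g} (δ : Word g) {i j} → π δ j ∈ cycle δ i → j ∈ cycle δ i
∈-cycle-π⁻ δ {i} {j} πj∈ = ∈-cycle-trans δ (∈-cycle-sym δ (∈-cycle⁺ δ j 1)) πj∈

-- Extending the product by `Sign.+` to all points makes reindexing along a permutation available.
foldr-filter : ∀ {A : Set} {n} {Q : A → Set} (Q? : ∀ x → Dec (Q x)) (s : A → Sign) (h : Fin n → A) →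
               foldr Sign._*_ Sign.+ (map s (filter Q? (tabulate h))) ≡
               ∏ (λ i → if does (Q? (h i)) then s (h i) else Sign.+)
foldr-filter {n = zero}  Q? s h = refl
foldr-filter {n = suc n} Q? s h with does (Q? (h zero))
... | true  = cong (s (h zero) Sign.*_) (foldr-filter Q? s (h ∘ suc))
... | false = foldr-filter Q? s (h ∘ suc)

-- An orientation t exhibits ε as the coboundary i ↦ t (π i) · t i, whose product over a cycle is 1.
orientation⇒sgnᶜ : ∀ {g} (δ : Word g) c t → IsOrientation δ (cycle δ c) t → sgnᶜ δ (cycle δ c) ≡ Sign.+
orientation⇒sgnᶜ δ c t orient = trans (foldr-filter (_∈? C) (sgn δ) id)
  (Sign.*-cancelʳ-≡ (∏ tᶜ) _ _ (begin
    ∏ εᶜ Sign.* ∏ tᶜ             ≡⟨ ∏-distrib εᶜ tᶜ ⟨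
    ∏ (λ i → εᶜ i Sign.* tᶜ i)   ≡⟨ ∏-cong pointwise ⟩
    ∏ (tᶜ ∘ π δ)                 ≡⟨ ∏-permute tᶜ (πOrbit.perm δ) ⟨
    ∏ tᶜ                         ∎))
  where
  open ≡-Reasoning
  C = cycle δ c
  εᶜ tᶜ : Fin _ → Sign
  εᶜ i = if does (i ∈? C) then sgn δ i else Sign.+
  tᶜ i = if does (i ∈? C) then lookup t i else Sign.+
  pointwise : ∀ i → εᶜ i Sign.* tᶜ i ≡ tᶜ (π δ i)
  pointwise i with i ∈? C | π δ i ∈? C
  ... | yes i∈ | yes _   = sym (orient i i∈)
  ... | yes i∈ | no πi∉  = contradiction (∈-cycle-π δ i∈) πi∉
  ... | no i∉  | yes πi∈ = contradiction (∈-cycle-π⁻ δ πi∈) i∉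
  ... | no _   | no _    = refl

-- Words with the same cycles are equal

lookup-ext : ∀ {A : Set} {n} {u v : Vec A n} → (∀ i → lookup u i ≡ lookup v i) → u ≡ v
lookup-ext {u = u} {v} e = trans (sym (tabulate∘lookup u)) (trans (tabulate-cong e) (tabulate∘lookup v))

π-one-cancel : ∀ {g} (δ : Word g) {i j} → lookup δ i ≡ true → lookup δ j ≡ true →
               toℕ (π δ i) < toℕ (π δ j) → toℕ i < toℕ j
π-one-cancel δ {i} {j} ei ej lt with <-cmp (toℕ i) (toℕ j)
... | tri< i<j _ _ = i<j
... | tri≈ _ eq _  = contradiction lt (<-irrefl (cong (λ k → toℕ (π δ k)) (toℕ-injective eq)))
... | tri> _ _ j<i = contradiction lt (<-asym (π-one-mono δ ej ei j<i))

π-zero-cancel : ∀ {g} (δ : Word g) {i j} → lookup δ i ≡ false → lookup δ j ≡ false →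
                toℕ (π δ i) < toℕ (π δ j) → toℕ j < toℕ i
π-zero-cancel δ {i} {j} ei ej lt with <-cmp (toℕ i) (toℕ j)
... | tri< i<j _ _ = contradiction lt (<-asym (π-zero-anti δ ei ej i<j))
... | tri≈ _ eq _  = contradiction lt (<-irrefl (cong (λ k → toℕ (π δ k)) (toℕ-injective eq)))
... | tri> _ _ j<i = j<i

-- A letter-preserving bijection that commutes with the permutations. It is a relation so that
-- points on a cycle and points off it can be matched by separate clauses.
record Conjugacy {g : ℕ} (δ δ′ : Word g) : Set₁ where
  field
    _~_     : Fin g → Fin g → Set
    totalˡ  : ∀ x → ∃ λ x′ → x ~ x′
    totalʳ  : ∀ x′ → ∃ λ x → x ~ x′
    uniqueʳ : ∀ {x x′ x″} → x ~ x′ → x ~ x″ → x′ ≡ x″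
    uniqueˡ : ∀ {x y x′} → x ~ x′ → y ~ x′ → x ≡ y
    step    : ∀ {x x′} → x ~ x′ → π δ x ~ π δ′ x′
    letter  : ∀ {x x′} → x ~ x′ → lookup δ x ≡ lookup δ′ x′

-- As in the Gessel–Reutenauer correspondence, δ is determined by the words
-- read along its cycles: pulling a pair inverted by θ back along π gives an
-- inverted pair carrying equal letters, so by periodicity θ inverts only pairs
-- carrying equal letters.
module _ {g : ℕ} {δ δ′ : Word g} (conj : Conjugacy δ δ′) where
  open Conjugacy conj

  private
    θ θ⁻¹ : Fin g → Fin g
    θ x   = proj₁ (totalˡ x)
    θ⁻¹ x = proj₁ (totalʳ x)

    θ∘θ⁻¹ : ∀ x → θ (θ⁻¹ x) ≡ x
    θ∘θ⁻¹ x = uniqueʳ (proj₂ (totalˡ (θ⁻¹ x))) (proj₂ (totalʳ x))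

    θ-injective : ∀ {x y} → θ x ≡ θ y → x ≡ y
    θ-injective {x} {y} e = uniqueˡ (proj₂ (totalˡ x)) (subst (y ~_) (sym e) (proj₂ (totalˡ y)))

    θ⁻¹-injective : ∀ {x y} → θ⁻¹ x ≡ θ⁻¹ y → x ≡ y
    θ⁻¹-injective {x} {y} e = trans (sym (θ∘θ⁻¹ x)) (trans (cong θ e) (θ∘θ⁻¹ y))

    θ-π : ∀ x → θ (π δ x) ≡ π δ′ (θ x)
    θ-π x = uniqueʳ (proj₂ (totalˡ (π δ x))) (step (proj₂ (totalˡ x)))

    θ-letter : ∀ x → lookup δ′ (θ x) ≡ lookup δ x
    θ-letter x = sym (letter (proj₂ (totalˡ x)))

    Inv Cross : Fin g → Fin g → Set
    Inv u v = toℕ u < toℕ v × toℕ (θ v) < toℕ (θ u)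
    Cross u v = Inv u v ⊎ Inv v u

    -- In both words images of ones precede images of zeros, so unequal letters could not produce an
    -- inversion. Two zeros reverse the order on both sides, which exchanges the roles of `u` and
    -- `v`; hence the symmetric `Cross`.
    pull-Inv : ∀ {u v} → Inv (π δ u) (π δ v) → Cross u v × lookup δ u ≡ lookup δ v
    pull-Inv {u} {v} (lt , gt) with true⊎false (lookup δ u) | true⊎false (lookup δ v) | subst₂ (λ a b → toℕ a < toℕ b) (θ-π v) (θ-π u) gt
    ... | inj₁ eu | inj₁ ev | gt′ = inj₁ (π-one-cancel δ eu ev lt ,
      π-one-cancel δ′ (trans (θ-letter v) ev) (trans (θ-letter u) eu) gt′) , trans eu (sym ev)
    ... | inj₁ eu | inj₂ ev | gt′ =
      contradiction gt′ (<-asym (π-one-zero δ′ (trans (θ-letter u) eu) (trans (θ-letter v) ev)))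
    ... | inj₂ eu | inj₁ ev | gt′ = contradiction lt (<-asym (π-one-zero δ ev eu))
    ... | inj₂ eu | inj₂ ev | gt′ = inj₂ (π-zero-cancel δ eu ev lt ,
      π-zero-cancel δ′ (trans (θ-letter v) ev) (trans (θ-letter u) eu) gt′) , trans eu (sym ev)

    pull : ∀ {u v} → Cross (π δ u) (π δ v) → Cross u v × lookup δ u ≡ lookup δ v
    pull (inj₁ c) = pull-Inv c
    pull (inj₂ c) with pull-Inv c
    ... | c′ , e = swap c′ , sym e

    pull-^^ : ∀ n {u v} → Cross ((π δ ^^ n) u) ((π δ ^^ n) v) → Cross u v
    pull-^^ zero    c = c
    pull-^^ (suc n) c = pull-^^ n (proj₁ (pull c))

    cross-letter : ∀ {u v} → Cross u v → lookup δ u ≡ lookup δ v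
    cross-letter {u} {v} c with πOrbit.period δ u | πOrbit.period δ v
    ... | N , _ , eN | M , _ , eM = proj₂ (pull (pull-^^ n
        (subst₂ Cross (sym (trans (^^-shift (π δ) n u) u-period)) (sym (trans (^^-shift (π δ) n v) v-period)) c)))
      where
      -- `suc n` is the product of the two periods, so both points return after `suc n` steps.
      -- Pulling back `n` of them leaves one step, which reads off the letters.
      n : ℕ
      n = N + M * suc N
      u-period : (π δ ^^ suc n) u ≡ u
      u-period = ^^-period-* (π δ) {suc N} eN (suc M)
      v-period : (π δ ^^ suc n) v ≡ v
      v-period = trans (cong (λ k → (π δ ^^ k) v) (*-comm (suc M) (suc N))) (^^-period-* (π δ) {suc M} eM (suc N))

    inv-letter : ∀ {u v} → toℕ u < toℕ v → toℕ (θ v) < toℕ (θ u) → lookup δ u ≡ lookup δ v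
    inv-letter lt gt = cross-letter (inj₁ (lt , gt))

    θ-distinct : ∀ {u v} → toℕ u < toℕ v → toℕ (θ v) ≤ toℕ (θ u) → toℕ (θ v) < toℕ (θ u)
    θ-distinct u<v le = ≤∧≢⇒< le (λ e → <-irrefl (cong toℕ (sym (θ-injective (toℕ-injective e)))) u<v)

    -- If `θ` moves `i` up, then injectivity provides a later point moved to `i` or below; if it
    -- moves `i` down, an earlier point moved to `i` or above. Either `i` and `θ⁻¹ i` are equal or
    -- inverted themselves, or both are inverted with that point.
    letter-at : ∀ i → lookup δ i ≡ lookup δ (θ⁻¹ i)
    letter-at i with θ⁻¹ i | θ∘θ⁻¹ i | <-cmp (toℕ (θ i)) (toℕ i)
    ... | w | θw≡i | tri≈ _ eq _ = cong (lookup δ) (θ-injective (trans (toℕ-injective eq) (sym θw≡i)))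
    ... | w | refl | tri> _ _ i<θi with injective⇒existsPivot θ⁻¹-injective i
    ...   | j , j≤i , i≤y with θ⁻¹ j | θ∘θ⁻¹ j
    ...     | y | refl = go (<-cmp (toℕ w) (toℕ i))
      where
      i<y : toℕ i < toℕ y
      i<y = ≤∧≢⇒< i≤y (λ e → <⇒≱ i<θi (subst (λ z → toℕ (θ z) ≤ toℕ i) (sym (toℕ-injective e)) j≤i))
      i≈y : lookup δ i ≡ lookup δ y
      i≈y = inv-letter i<y (≤-<-trans j≤i i<θi)
      go : _ → lookup δ i ≡ lookup δ w
      go (tri< w<i _ _) = trans i≈y (sym (inv-letter (<-trans w<i i<y) (θ-distinct (<-trans w<i i<y) j≤i)))
      go (tri≈ _ eq _)  = cong (lookup δ) (sym (toℕ-injective eq))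
      go (tri> _ _ i<w) = inv-letter i<w i<θi
    letter-at i | w | refl | tri< θi<i _ _ with injective⇒existsPivot θ-injective i
    ...   | j , j≤i , i≤θj = go (<-cmp (toℕ w) (toℕ i))
      where
      j<i : toℕ j < toℕ i
      j<i = ≤∧≢⇒< j≤i (λ e → <⇒≱ θi<i (subst (λ z → toℕ i ≤ toℕ (θ z)) (toℕ-injective e) i≤θj))
      j≈i : lookup δ j ≡ lookup δ i
      j≈i = inv-letter j<i (<-≤-trans θi<i i≤θj)
      go : _ → lookup δ i ≡ lookup δ w
      go (tri< w<i _ _) = sym (inv-letter w<i θi<i)
      go (tri≈ _ eq _)  = cong (lookup δ) (sym (toℕ-injective eq))
      go (tri> _ _ i<w) = trans (sym j≈i) (inv-letter (<-trans j<i i<w) (θ-distinct (<-trans j<i i<w) i≤θj))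

  conjugacy⇒≡ : δ ≡ δ′
  conjugacy⇒≡ = lookup-ext λ i →
    trans (letter-at i) (letter (proj₂ (totalʳ i)))

-- The letters off a cycle

off : ∀ {n} → Word n → Subset n → List Bool
off []      []          = []
off (b ∷ δ) (true ∷ D)  = off δ D
off (b ∷ δ) (false ∷ D) = b ∷ off δ D

rank : ∀ {n} → Subset n → Fin n → ℕ
rank (d ∷ D) zero    = 0
rank (d ∷ D) (suc i) = bit (not d) + rank D i

off-at : ∀ {n} (δ : Word n) D {i} → i ∉ D → ∃ λ s → drop (rank D i) (off δ D) ≡ lookup δ i ∷ s
off-at (b ∷ δ) (true ∷ D)  {zero}  i∉ = ⊥-elim (i∉ here)
off-at (b ∷ δ) (false ∷ D) {zero}  i∉ = off δ D , refl
off-at (b ∷ δ) (true ∷ D)  {suc i} i∉ = off-at δ D (i∉ ∘ there)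
off-at (b ∷ δ) (false ∷ D) {suc i} i∉ = off-at δ D (i∉ ∘ there)

rank< : ∀ {n} (δ : Word n) D {i} → i ∉ D → rank D i < length (off δ D)
rank< (b ∷ δ) (true ∷ D)  {zero}  i∉ = ⊥-elim (i∉ here)
rank< (b ∷ δ) (false ∷ D) {zero}  i∉ = s≤s z≤n
rank< (b ∷ δ) (true ∷ D)  {suc i} i∉ = rank< δ D (i∉ ∘ there)
rank< (b ∷ δ) (false ∷ D) {suc i} i∉ = s≤s (rank< δ D (i∉ ∘ there))

rank-surjective : ∀ {n} (δ : Word n) D {k} → k < length (off δ D) → ∃ λ i → i ∉ D × rank D i ≡ k
rank-surjective []      []          ()
rank-surjective (b ∷ δ) (true ∷ D)  k< with rank-surjective δ D k<
... | i , i∉ , e = suc i , (λ { (there i∈) → i∉ i∈ }) , e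
rank-surjective (b ∷ δ) (false ∷ D) {zero}  _        = zero , (λ ()) , refl
rank-surjective (b ∷ δ) (false ∷ D) {suc k} (s≤s k<) with rank-surjective δ D k<
... | i , i∉ , e = suc i , (λ { (there i∈) → i∉ i∈ }) , cong suc e

rank-injective : ∀ {n} (D : Subset n) {i j} → i ∉ D → j ∉ D → rank D i ≡ rank D j → i ≡ j
rank-injective (d ∷ D)     {zero}  {zero}  _  _  _  = refl
rank-injective (true ∷ D)  {zero}  {suc j} i∉ _  _  = ⊥-elim (i∉ here)
rank-injective (false ∷ D) {zero}  {suc j} _  _  ()
rank-injective (true ∷ D)  {suc i} {zero}  _  j∉ _  = ⊥-elim (j∉ here)
rank-injective (false ∷ D) {suc i} {zero}  _  _  ()
rank-injective (d ∷ D)     {suc i} {suc j} i∉ j∉ e  =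
  cong suc (rank-injective D (i∉ ∘ there) (j∉ ∘ there) (+-cancelˡ-≡ (bit (not d)) _ _ e))

∑-zero : ∀ {n} {h : Fin n → ℕ} → (∀ i → h i ≡ 0) → ∑ h ≡ 0
∑-zero {zero}  e = refl
∑-zero {suc n} e = cong₂ _+_ (e zero) (∑-zero (e ∘ suc))

bit-∧-false : ∀ b → bit (b ∧ false) ≡ 0
bit-∧-false b = cong bit (∧-zeroʳ b)

-- As a sum over all points the rank can be reindexed along the permutation; the sums below serve
-- the same purpose.
rank-∑ : ∀ {n} (D : Subset n) x → ∑ (λ i → bit (not (lookup D i) ∧ (toℕ i <ᵇ toℕ x))) ≡ rank D x
rank-∑ (d ∷ D) zero    = ∑-zero {h = λ i → bit (not (lookup (d ∷ D) i) ∧ false)} (λ i → bit-∧-false _)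
rank-∑ (d ∷ D) (suc x) = cong₂ _+_ (cong bit (∧-identityʳ (not d))) (rank-∑ D x)

ones-∑ : ∀ {n} (δ : Word n) D x →
         ∑ (λ i → bit (not (lookup D i) ∧ (lookup δ i ∧ (toℕ i <ᵇ toℕ x)))) ≡ ones (take (rank D x) (off δ D))
ones-∑ (b ∷ δ) (d ∷ D) zero =
  ∑-zero {h = λ i → bit (not (lookup (d ∷ D) i) ∧ (lookup (b ∷ δ) i ∧ false))}
    (λ i → trans (cong (λ c → bit (not (lookup (d ∷ D) i) ∧ c)) (∧-zeroʳ _)) (bit-∧-false _))
ones-∑ (b ∷ δ)     (true ∷ D)  (suc x) = ones-∑ δ D x
ones-∑ (true ∷ δ)  (false ∷ D) (suc x) = cong suc (ones-∑ δ D x)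
ones-∑ (false ∷ δ) (false ∷ D) (suc x) = ones-∑ δ D x

length-off-∑ : ∀ {n} (δ : Word n) D → ∑ (λ i → bit (not (lookup D i))) ≡ length (off δ D)
length-off-∑ []      []          = refl
length-off-∑ (b ∷ δ) (true ∷ D)  = length-off-∑ δ D
length-off-∑ (b ∷ δ) (false ∷ D) = cong suc (length-off-∑ δ D)

-- The images that precede the image of a zero are those of all ones and of all later zeros: the
-- ones up to that zero and every letter beyond it.
onesOrLater : ℕ → List Bool → ℕ
onesOrLater k w = ones (take k w) + length (drop k w)

onesOrLater-∑ : ∀ {n} (δ : Word n) D {x} → x ∉ D →
                ∑ (λ i → bit (not (lookup D i) ∧ (lookup δ i ∨ (toℕ x <ᵇ toℕ i)))) ≡
                onesOrLater (suc (rank D x)) (off δ D)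
onesOrLater-∑ (b ∷ δ) (true ∷ D) {zero} x∉ = ⊥-elim (x∉ here)
onesOrLater-∑ (b ∷ δ) (false ∷ D) {zero} x∉ = go b
  where
  tail-∑ : ∑ (λ i → bit (not (lookup D i) ∧ (lookup δ i ∨ true))) ≡ length (off δ D)
  tail-∑ = trans (∑-cong (λ i → cong bit (trans (cong (not (lookup D i) ∧_) (∨-zeroʳ _)) (∧-identityʳ _)))) (length-off-∑ δ D)
  go : ∀ b → bit (b ∨ false) + ∑ (λ i → bit (not (lookup D i) ∧ (lookup δ i ∨ true))) ≡ onesOrLater 1 (b ∷ off δ D)
  go true  = cong suc tail-∑
  go false = tail-∑
onesOrLater-∑ (b ∷ δ)     (true ∷ D)  {suc x} x∉ = onesOrLater-∑ δ D (x∉ ∘ there)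
onesOrLater-∑ (true ∷ δ)  (false ∷ D) {suc x} x∉ = cong suc (onesOrLater-∑ δ D (x∉ ∘ there))
onesOrLater-∑ (false ∷ δ) (false ∷ D) {suc x} x∉ = onesOrLater-∑ δ D (x∉ ∘ there)

<ᵇ-true : ∀ {m n} → m < n → (m <ᵇ n) ≡ true
<ᵇ-true {zero}  (s≤s _) = refl
<ᵇ-true {suc m} (s≤s p) = <ᵇ-true p

<ᵇ-false : ∀ {m n} → ¬ m < n → (m <ᵇ n) ≡ false
<ᵇ-false {m}     {zero}  _ = refl
<ᵇ-false {zero}  {suc n} p = contradiction (s≤s z≤n) p
<ᵇ-false {suc m} {suc n} p = <ᵇ-false (p ∘ s≤s)

π-<ᵇ-one : ∀ {g} (δ : Word g) {x} → lookup δ x ≡ true → ∀ i →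
           (toℕ (π δ i) <ᵇ toℕ (π δ x)) ≡ lookup δ i ∧ (toℕ i <ᵇ toℕ x)
π-<ᵇ-one δ {x} ex i with true⊎false (lookup δ i) | toℕ i <? toℕ x
... | inj₁ ei | yes i<x = trans (<ᵇ-true (π-one-mono δ ei ex i<x)) (sym (cong₂ _∧_ ei (<ᵇ-true i<x)))
... | inj₁ ei | no i≮x  = trans (<ᵇ-false (i≮x ∘ π-one-cancel δ ei ex)) (sym (cong₂ _∧_ ei (<ᵇ-false i≮x)))
... | inj₂ ei | _       = trans (<ᵇ-false (<-asym (π-one-zero δ ex ei))) (sym (cong (_∧ _) ei))

π-<ᵇ-zero : ∀ {g} (δ : Word g) {x} → lookup δ x ≡ false → ∀ i →
            (toℕ (π δ i) <ᵇ toℕ (π δ x)) ≡ lookup δ i ∨ (toℕ x <ᵇ toℕ i)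
π-<ᵇ-zero δ {x} ex i with true⊎false (lookup δ i) | toℕ x <? toℕ i
... | inj₁ ei | _       = trans (<ᵇ-true (π-one-zero δ ei ex)) (sym (cong (_∨ _) ei))
... | inj₂ ei | yes x<i = trans (<ᵇ-true (π-zero-anti δ ex ei x<i)) (sym (cong₂ _∨_ ei (<ᵇ-true x<i)))
... | inj₂ ei | no x≮i  = trans (<ᵇ-false (x≮i ∘ π-zero-cancel δ ei ex)) (sym (cong₂ _∨_ ei (<ᵇ-false x≮i)))

module _ {g : ℕ} (δ : Word g) (D : Subset g) (D-invariant : ∀ i → lookup D (π δ i) ≡ lookup D i) where

  private
    reindex : ∀ x {c : Fin g → Bool} → (∀ i → (toℕ (π δ i) <ᵇ toℕ (π δ x)) ≡ c i) →
              rank D (π δ x) ≡ ∑ (λ i → bit (not (lookup D i) ∧ c i))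
    reindex x {c} e = begin
      rank D (π δ x)                                                              ≡⟨ rank-∑ D (π δ x) ⟨
      ∑ (λ i → bit (not (lookup D i) ∧ (toℕ i <ᵇ toℕ (π δ x))))                   ≡⟨ ∑-permute _ (πOrbit.perm δ) ⟩
      ∑ (λ i → bit (not (lookup D (π δ i)) ∧ (toℕ (π δ i) <ᵇ toℕ (π δ x))))
        ≡⟨ ∑-cong (λ i → cong bit (cong₂ (λ d b → not d ∧ b) (D-invariant i) (e i))) ⟩
      ∑ (λ i → bit (not (lookup D i) ∧ c i))                                      ∎
      where open ≡-Reasoning

  -- Deleting an invariant set preserves the rule of `π`: the new rank depends only on the old rank
  -- and on the remaining word.
  rank-π-one : ∀ {x} → lookup δ x ≡ true → rank D (π δ x) ≡ ones (take (rank D x) (off δ D))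
  rank-π-one {x} e = trans (reindex x (π-<ᵇ-one δ e)) (ones-∑ δ D x)

  rank-π-zero : ∀ {x} → x ∉ D → lookup δ x ≡ false → rank D (π δ x) ≡ onesOrLater (suc (rank D x)) (off δ D)
  rank-π-zero {x} x∉ e = trans (reindex x (π-<ᵇ-zero δ e)) (onesOrLater-∑ δ D x∉)

lookup-⇔ : ∀ {n} (D : Subset n) {i j} → (i ∈ D → j ∈ D) → (j ∈ D → i ∈ D) → lookup D i ≡ lookup D j
lookup-⇔ D {i} {j} to from with true⊎false (lookup D i) | true⊎false (lookup D j)
... | inj₁ e | inj₁ e′ = trans e (sym e′)
... | inj₂ e | inj₂ e′ = trans e (sym e′)
... | inj₁ e | inj₂ e′ with () ← trans (sym e′) ([]=⇒lookup (to (lookup⇒[]= i D e)))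
... | inj₂ e | inj₁ e′ with () ← trans (sym e) ([]=⇒lookup (from (lookup⇒[]= j D e′)))

-- A cycle together with the word off it

record IsOrbit {g : ℕ} (δ : Word g) (x : Fin g) (D : Subset g) (N : ℕ) : Set where
  field
    period    : (π δ ^^ suc N) x ≡ x
    minimal   : ∀ {m n} → m < suc N → n < suc N → (π δ ^^ m) x ≡ (π δ ^^ n) x → m ≡ n
    member    : ∀ n → (π δ ^^ n) x ∈ D
    index     : ∀ {y} → y ∈ D → ∃ λ n → n < suc N × y ≡ (π δ ^^ n) x
    closed    : ∀ {y} → y ∈ D → π δ y ∈ D
    coclosed  : ∀ {y} → π δ y ∈ D → y ∈ D

cycle-isOrbit : ∀ {g} (δ : Word g) x → ∃ (IsOrbit δ x (cycle δ x))
cycle-isOrbit δ x with πOrbit.min-period δ x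
... | N , _ , e , min = N , record
  { period = e ; minimal = min ; member = ∈-cycle⁺ δ x ; closed = ∈-cycle-π δ ; coclosed = ∈-cycle-π⁻ δ
  ; index = λ y∈ → let n , eq = ∈-cycle⁻ δ y∈ ; k , k< , eq′ = ^^-reduce (π δ) {N} e n in k , k< , trans eq eq′ }

module _ {g : ℕ} (δ : Word g) (x : Fin g) (D : Subset g) {N : ℕ} (orb : IsOrbit δ x D N) where

  private
    module O = IsOrbit orb

  private
    Index : Set
    Index = ℕ ⊎ ℕ

    indices : List Index
    indices = map inj₁ (upTo (suc N)) ++ map inj₂ (upTo (length (off δ D)))

    _≈_ : Index → Fin g → Set
    inj₁ n ≈ y = n < suc N × y ≡ (π δ ^^ n) x
    inj₂ k ≈ y = y ∉ D × rank D y ≡ k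

    length-indices : length indices ≡ suc N + length (off δ D)
    length-indices = trans (length-++ (map inj₁ (upTo (suc N))))
      (cong₂ _+_ (trans (length-map inj₁ (upTo (suc N))) (length-upTo (suc N)))
                 (trans (length-map inj₂ (upTo (length (off δ D)))) (length-upTo _)))

    unique : Unique indices
    unique = ++⁺ (map⁺ inj₁-injective (upTo⁺ (suc N))) (map⁺ inj₂-injective (upTo⁺ _))
      λ { (p , q) → disjoint (∈-map⁻ inj₁ p) (∈-map⁻ inj₂ q) }
      where
      disjoint : ∀ {i as bs} → (∃ λ a → a ∈ˡ as × i ≡ inj₁ a) → (∃ λ b → b ∈ˡ bs × i ≡ inj₂ b) → ⊥
      disjoint (_ , _ , refl) (_ , _ , ())

    index′ : ∀ y → ∃ λ i → i ∈ˡ indices × i ≈ y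
    index′ y with y ∈? D
    ... | no y∉ = inj₂ (rank D y) , ∈-++⁺ʳ _ (∈-map⁺ inj₂ (∈-upTo⁺ (rank< δ D y∉))) , y∉ , refl
    ... | yes y∈ with O.index y∈
    ... | n , n< , e = inj₁ n , ∈-++⁺ˡ (∈-map⁺ inj₁ (∈-upTo⁺ n<)) , n< , e

    point : ∀ {i} → i ∈ˡ indices → ∃ λ y → y ∈ˡ allFin g × i ≈ y
    point i∈ with ∈-++⁻ (map inj₁ (upTo (suc N))) i∈
    ... | inj₁ p with ∈-map⁻ inj₁ p
    ...   | n , n∈ , refl = (π δ ^^ n) x , ∈-allFin _ , ∈-upTo⁻ n∈ , refl
    point i∈ | inj₂ p with ∈-map⁻ inj₂ p
    ...   | k , k∈ , refl with rank-surjective δ D (∈-upTo⁻ k∈)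
    ...     | y , y∉ , e = y , ∈-allFin y , y∉ , e

    ≈-functional : ∀ {i y y′} → i ≈ y → i ≈ y′ → y ≡ y′
    ≈-functional {inj₁ n} (_ , e)  (_ , e′)   = trans e (sym e′)
    ≈-functional {inj₂ k} (y∉ , e) (y′∉ , e′) = rank-injective D y∉ y′∉ (trans e (sym e′))

    ≈-injective : ∀ {i i′ y} → i ≈ y → i′ ≈ y → i ≡ i′
    ≈-injective {inj₁ n} {inj₁ m} (n< , e)   (m< , e′)   = cong inj₁ (O.minimal n< m< (trans (sym e) e′))
    ≈-injective {inj₁ n} {inj₂ k} (_ , refl) (y∉ , _)    = contradiction (O.member n) y∉
    ≈-injective {inj₂ k} {inj₁ n} (y∉ , _)   (_ , refl)  = contradiction (O.member n) y∉
    ≈-injective {inj₂ k} {inj₂ l} (_ , e)    (_ , e′)    = cong inj₂ (trans (sym e) e′)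

  -- Every point has exactly one address, a time on the cycle or a rank off it; injections in both
  -- directions compare the counts.
  length-cycle+off : suc N + length (off δ D) ≡ g
  length-cycle+off = ≤-antisym
    (subst₂ _≤_ length-indices (length-tabulate {n = g} id) (length-≤ _≈_ unique point ≈-injective))
    (subst₂ _≤_ (length-tabulate {n = g} id) length-indices
      (length-≤ (λ y i → i ≈ y) (allFin⁺ g) (λ {y} _ → index′ y) ≈-functional))

orbitWord : ∀ {g} → Word g → Fin g → ℕ → List Bool
orbitWord δ x n = map (lookup δ) (iterate (π δ) x n)

orbitWord-at : ∀ {g} (δ δ′ : Word g) N {x x′} → orbitWord δ x N ≡ orbitWord δ′ x′ N →
               ∀ {n} → n < N → lookup δ ((π δ ^^ n) x) ≡ lookup δ′ ((π δ′ ^^ n) x′)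
orbitWord-at δ δ′ (suc N) e {zero} n< = ∷-injectiveˡ e
orbitWord-at δ δ′ (suc N) {x} {x′} e {suc n} (s≤s n<) = subst₂ (λ y y′ → lookup δ y ≡ lookup δ′ y′)
  (^^-shift (π δ) n x) (^^-shift (π δ′) n x′) (orbitWord-at δ δ′ N (∷-injectiveʳ e) n<)

module _ {g : ℕ} {δ δ′ : Word g} {x x′ : Fin g} {D D′ : Subset g} {N : ℕ}
         (orb : IsOrbit δ x D N) (orb′ : IsOrbit δ′ x′ D′ N)
         (orbit≡ : orbitWord δ x (suc N) ≡ orbitWord δ′ x′ (suc N))
         (off≡ : off δ D ≡ off δ′ D′) where

  private
    module O  = IsOrbit orb
    module O′ = IsOrbit orb′

    _~_ : Fin g → Fin g → Set
    y ~ y′ = (∃ λ n → n < suc N × y ≡ (π δ ^^ n) x × y′ ≡ (π δ′ ^^ n) x′) ⊎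
             (y ∉ D × y′ ∉ D′ × rank D y ≡ rank D′ y′)

    totalˡ : ∀ y → ∃ λ y′ → y ~ y′
    totalˡ y with y ∈? D
    ... | yes y∈ with O.index y∈
    ...   | n , n< , e = (π δ′ ^^ n) x′ , inj₁ (n , n< , e , refl)
    totalˡ y | no y∉ with rank-surjective δ′ D′ (<-≤-trans (rank< δ D y∉) (≤-reflexive (cong length off≡)))
    ...   | y′ , y′∉ , e = y′ , inj₂ (y∉ , y′∉ , sym e)

    totalʳ : ∀ y′ → ∃ λ y → y ~ y′
    totalʳ y′ with y′ ∈? D′
    ... | yes y∈ with O′.index y∈
    ...   | n , n< , e = (π δ ^^ n) x , inj₁ (n , n< , refl , e)
    totalʳ y′ | no y∉ with rank-surjective δ D (<-≤-trans (rank< δ′ D′ y∉) (≤-reflexive (cong length (sym off≡))))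
    ...   | y , y′∉ , e = y , inj₂ (y′∉ , y∉ , e)

    uniqueʳ : ∀ {y y′ y″} → y ~ y′ → y ~ y″ → y′ ≡ y″
    uniqueʳ (inj₁ (n , n< , e , refl)) (inj₁ (m , m< , f , refl)) =
      cong (λ k → (π δ′ ^^ k) x′) (O.minimal n< m< (trans (sym e) f))
    uniqueʳ (inj₁ (n , _ , refl , _)) (inj₂ (y∉ , _)) = contradiction (O.member n) y∉
    uniqueʳ (inj₂ (y∉ , _)) (inj₁ (n , _ , refl , _)) = contradiction (O.member n) y∉
    uniqueʳ (inj₂ (_ , p , e)) (inj₂ (_ , q , f)) = rank-injective D′ p q (trans (sym e) f)

    uniqueˡ : ∀ {y z y′} → y ~ y′ → z ~ y′ → y ≡ z
    uniqueˡ (inj₁ (n , n< , refl , e)) (inj₁ (m , m< , refl , f)) =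
      cong (λ k → (π δ ^^ k) x) (O′.minimal n< m< (trans (sym e) f))
    uniqueˡ (inj₁ (n , _ , _ , refl)) (inj₂ (_ , y∉ , _)) = contradiction (O′.member n) y∉
    uniqueˡ (inj₂ (_ , y∉ , _)) (inj₁ (n , _ , _ , refl)) = contradiction (O′.member n) y∉
    uniqueˡ (inj₂ (p , _ , e)) (inj₂ (q , _ , f)) = rank-injective D p q (trans e (sym f))

    letter : ∀ {y y′} → y ~ y′ → lookup δ y ≡ lookup δ′ y′
    letter (inj₁ (n , n< , refl , refl)) = orbitWord-at δ δ′ (suc N) orbit≡ n<
    letter (inj₂ (y∉ , y′∉ , e)) with off-at δ D y∉ | off-at δ′ D′ y′∉
    ... | s , p | s′ , p′ = ∷-injectiveˡ (trans (sym p) (trans (cong₂ drop e off≡) p′))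

    step : ∀ {y y′} → y ~ y′ → π δ y ~ π δ′ y′
    step (inj₁ (n , n< , refl , refl)) with m≤n⇒m<n∨m≡n n<
    ... | inj₁ sn<  = inj₁ (suc n , sn< , refl , refl)
    ... | inj₂ refl = inj₁ (0 , s≤s z≤n , O.period , O′.period)
    step {y} {y′} r@(inj₂ (y∉ , y′∉ , e)) =
      inj₂ (y∉ ∘ O.coclosed , y′∉ ∘ O′.coclosed , rank≡ (true⊎false (lookup δ y)))
      where
      inv : ∀ i → lookup D (π δ i) ≡ lookup D i
      inv i = lookup-⇔ D O.coclosed O.closed
      inv′ : ∀ i → lookup D′ (π δ′ i) ≡ lookup D′ i
      inv′ i = lookup-⇔ D′ O′.coclosed O′.closed
      rank≡ : lookup δ y ≡ true ⊎ lookup δ y ≡ false → rank D (π δ y) ≡ rank D′ (π δ′ y′)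
      rank≡ (inj₁ l) = trans (rank-π-one δ D inv l) (trans (cong₂ (λ k w → ones (take k w)) e off≡)
        (sym (rank-π-one δ′ D′ inv′ (trans (sym (letter r)) l))))
      rank≡ (inj₂ l) = trans (rank-π-zero δ D inv y∉ l) (trans (cong₂ (λ k w → onesOrLater (suc k) w) e off≡)
        (sym (rank-π-zero δ′ D′ inv′ y′∉ (trans (sym (letter r)) l))))

  -- Points on the two cycles are matched by time and the others by rank. The first matching
  -- commutes with `π` because the lengths agree, the second because `rank-π-one` and `rank-π-zero`
  -- see only the word off the cycle.
  orbitWord-off-injective : δ ≡ δ′
  orbitWord-off-injective = conjugacy⇒≡ record
    { _~_ = _~_ ; totalˡ = totalˡ ; totalʳ = totalʳ ; uniqueʳ = uniqueʳ ; uniqueˡ = uniqueˡ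
    ; step = step ; letter = letter }

-- Failing words with a chain of heights

∈P : ∀ {g} {δ : Word g} {i} → lookup δ i ≡ true → i ∈ P δ
∈P {δ = δ} {i} = lookup⇒[]= i δ

∈P⁻ : ∀ {g} {δ : Word g} {i} → i ∈ P δ → lookup δ i ≡ true
∈P⁻ = []=⇒lookup

∈Z⁻ : ∀ {g} {δ : Word g} {i} → i ∈ Z δ → lookup δ i ≡ false
∈Z⁻ {δ = δ} {i} i∈ with true⊎false (lookup δ i)
... | inj₁ e = contradiction (lookup⇒[]= i δ e) (x∈∁p⇒x∉p i∈)
... | inj₂ e = e

sgn-true : ∀ {g} (δ : Word g) {i} → lookup δ i ≡ true → sgn δ i ≡ Sign.+
sgn-true δ = cong (λ b → if b then Sign.+ else Sign.-)

sgn-false : ∀ {g} (δ : Word g) {i} → lookup δ i ≡ false → sgn δ i ≡ Sign.-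
sgn-false δ = cong (λ b → if b then Sign.+ else Sign.-)

no-arrow⇒≡ : ∀ {g} {δ : Word g} {C C₀} → (∀ {C′} → ¬ Arrow δ C′ C) → Star (Arrow δ) C₀ C → C₀ ≡ C
no-arrow⇒≡ none ε       = refl
no-arrow⇒≡ none (e ◅ p) with no-arrow⇒≡ none p
... | refl = contradiction e none

unreachable⇒fails : ∀ {g} {δ : Word g} c → Bad δ (cycle δ c) → (∀ {C} → ¬ Arrow δ C (cycle δ c)) → ¬ Condition* δ
unreachable⇒fails {δ = δ} c bad none cond with cond (cycle δ c) (c , refl) bad
... | C₀ , _ , good , path = subst (Good δ) (no-arrow⇒≡ none path) good bad

-- The first point is then a fixed one: its cycle is bad and has no zero at which an arrow could
-- arrive.
one∷-fails : ∀ {g} (δ : Word g) → ¬ Condition* (true ∷ δ)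
one∷-fails {g} δ = unreachable⇒fails zero
  ((zero , x∈p∩q⁺ (∈-cycle-self δ₁ zero , ∈P {δ = δ₁} refl)) ,
   orientation⇒sgnᶜ δ₁ zero t orient , t , orient , λ i _ → lookup-replicate i Sign.+)
  λ { (_ , _ , _ , _ , _ , _ , _ , j , _ , j∈ , _ , _) → no-zero (x∈p∩q⁻ _ (Z δ₁) j∈) }
  where
  δ₁ = true ∷ δ
  t = Vec.replicate (suc g) Sign.+
  fixed-^^ : ∀ n → (π δ₁ ^^ n) zero ≡ zero
  fixed-^^ zero    = refl
  fixed-^^ (suc n) = cong (π δ₁) (fixed-^^ n)
  only : ∀ {i} → i ∈ cycle δ₁ zero → i ≡ zero
  only i∈ with ∈-cycle⁻ δ₁ i∈
  ... | n , e = trans e (fixed-^^ n)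
  orient : IsOrientation δ₁ (cycle δ₁ zero) t
  orient i i∈ with only i∈
  ... | refl = refl
  no-zero : ∀ {j} → ¬ (j ∈ cycle δ₁ zero × j ∈ Z δ₁)
  no-zero {j} (j∈ , j∈Z) with () ← trans (sym (∈Z⁻ {δ = δ₁} j∈Z)) (cong (lookup δ₁) (only j∈))

φ-ones : ∀ {g} (δ : Word g) i → φ δ i ≡ ones (take (toℕ i) (toList δ)) + bit (lookup δ i)
φ-ones (b ∷ δ)     zero    = refl
φ-ones (true ∷ δ)  (suc i) = cong suc (φ-ones δ i)
φ-ones (false ∷ δ) (suc i) = φ-ones δ i

φ-last : ∀ {n} (δ : Word (suc n)) → φ δ (fromℕ n) ≡ ones (toList δ)
φ-last {zero}  (true ∷ [])  = refl
φ-last {zero}  (false ∷ []) = refl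
φ-last {suc n} (true ∷ δ)   = cong suc (φ-last δ)
φ-last {suc n} (false ∷ δ)  = φ-last δ

drop-lookup : ∀ {A : Set} {n} (v : Vec A n) i → ∃ λ s → drop (toℕ i) (toList v) ≡ lookup v i ∷ s
drop-lookup (x ∷ v) zero    = toList v , refl
drop-lookup (x ∷ v) (suc i) = drop-lookup v i

π-height : ∀ {g} (δ : Word g) {i k} → lookup δ i ≡ true → toℕ i ≡ height (toList δ) k →
           toℕ (π δ i) ≡ height (toList δ) (suc k)
π-height δ {i} {k} e h = begin
  toℕ (π δ i)                                           ≡⟨ π-one δ i e ⟩
  pred (φ δ i)                                          ≡⟨ cong pred (φ-ones δ i) ⟩
  pred (ones (take (toℕ i) (toList δ)) + bit (lookup δ i)) ≡⟨ cong (λ b → pred (ones (take (toℕ i) (toList δ)) + bit b)) e ⟩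
  pred (ones (take (toℕ i) (toList δ)) + 1)             ≡⟨ cong pred (+-comm _ 1) ⟩
  ones (take (toℕ i) (toList δ))                        ≡⟨ cong (λ n → ones (take n (toList δ))) h ⟩
  height (toList δ) (suc k)                             ∎
  where open ≡-Reasoning

module _ {n : ℕ} (δ : Word (suc (suc n))) (first0 : lookup δ zero ≡ false) (last0 : lookup δ (fromℕ (suc n)) ≡ false)
         (some1 : 0 < ones (toList δ)) (chain : Chain (toList δ)) where

  private
    w : List Bool
    w = toList δ

    iₗ : Fin (suc (suc n))
    iₗ = fromℕ (suc n)

    data Chained (x : Fin (suc (suc n))) : Set where
      start : x ≡ zero → Chained x
      inner : ∀ k → lookup δ x ≡ true → toℕ x ≡ height w k → Chained x

    classify : ∀ y k → toℕ y ≡ height w (suc k) → Chained y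
    classify y k e with chain k
    ... | inj₁ h       = start (toℕ-injective (trans e h))
    ... | inj₂ (s , h) with drop-lookup δ y
    ...   | s′ , h′ = inner (suc k) (∷-injectiveˡ (trans (sym h′) (trans (cong (λ m → drop m w) e) h))) e

    π-first : π δ zero ≡ iₗ
    π-first = toℕ-injective (trans (π-zero δ zero first0) (trans (cong (suc (suc n) ∸_) (ζ-first δ first0)) (sym (toℕ-fromℕ (suc n)))))
      where
      ζ-first : ∀ {n} (δ : Word (suc n)) → lookup δ zero ≡ false → ζ δ zero ≡ 1
      ζ-first (false ∷ _) refl = refl

    π-last : toℕ (π δ iₗ) ≡ height w 1
    π-last = begin
      toℕ (π δ iₗ)                        ≡⟨ π-zero δ iₗ last0 ⟩
      suc (suc n) ∸ ζ δ iₗ                ≡⟨ cong (λ m → suc m ∸ ζ δ iₗ) (toℕ-fromℕ (suc n)) ⟨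
      suc (toℕ iₗ) ∸ ζ δ iₗ               ≡⟨ cong (_∸ ζ δ iₗ) (φ+ζ δ iₗ) ⟨
      φ δ iₗ + ζ δ iₗ ∸ ζ δ iₗ            ≡⟨ m+n∸n≡m (φ δ iₗ) (ζ δ iₗ) ⟩
      φ δ iₗ                              ≡⟨ φ-last δ ⟩
      ones w                              ≡⟨ height₁ w ⟨
      height w 1                          ∎
      where open ≡-Reasoning

    π-last-one : lookup δ (π δ iₗ) ≡ true
    π-last-one with classify (π δ iₗ) 0 π-last
    ... | inner _ e _ = e
    ... | start e = contradiction (trans (sym (cong toℕ e)) (trans π-last (height₁ w))) (<⇒≢ some1)

    InD : Fin (suc (suc n)) → Set
    InD x = x ≡ iₗ ⊎ Chained x

    step : ∀ {x} → InD x → InD (π δ x)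
    step (inj₁ refl)            = inj₂ (inner 1 π-last-one π-last)
    step (inj₂ (start refl))    = inj₁ π-first
    step (inj₂ (inner k e h))   = inj₂ (classify _ k (π-height δ {k = k} e h))

    orbit : ∀ k → InD ((π δ ^^ k) zero)
    orbit zero    = inj₂ (start refl)
    orbit (suc k) = step (orbit k)

    ∈D : ∀ {i} → i ∈ cycle δ zero → InD i
    ∈D i∈ with ∈-cycle⁻ δ i∈
    ... | k , refl = orbit k

    -- The cycle has just two zeros, its first and last points, at which the sign changes; so the
    -- last point alone is negative.
    t : Vec Sign (suc (suc n))
    t = Vec.replicate _ Sign.+ [ iₗ ]≔ Sign.-

    t-last : lookup t iₗ ≡ Sign.-
    t-last = lookup∘update iₗ (Vec.replicate _ Sign.+) Sign.-

    t-chained : ∀ {x} → Chained x → lookup t x ≡ Sign.+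
    t-chained {x} c = trans (lookup∘update′ (x≢iₗ c) (Vec.replicate _ Sign.+) Sign.-) (lookup-replicate x Sign.+)
      where
      x≢iₗ : Chained x → x ≢ iₗ
      x≢iₗ (start refl) ()
      x≢iₗ (inner _ e _) refl with () ← trans (sym e) last0

    orient : IsOrientation δ (cycle δ zero) t
    orient i i∈ with ∈D i∈
    ... | inj₁ refl = trans (t-chained (inner 1 π-last-one π-last)) (sym (cong₂ Sign._*_ (sgn-false δ last0) t-last))
    ... | inj₂ (start refl) = trans (trans (cong (lookup t) π-first) t-last)
      (sym (cong₂ Sign._*_ (sgn-false δ first0) (t-chained (start refl))))
    ... | inj₂ c@(inner k e h) = trans (t-chained (classify _ k (π-height δ {k = k} e h)))
      (sym (cong₂ Sign._*_ (sgn-true δ e) (t-chained c)))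

    positive : ∀ i → i ∈ cycle δ zero ∩ P δ → lookup t i ≡ Sign.+
    positive i i∈ with x∈p∩q⁻ _ (P δ) i∈
    ... | i∈D , i∈P with ∈D i∈D
    ... | inj₁ refl with () ← trans (sym last0) (∈P⁻ {δ = δ} i∈P)
    ... | inj₂ c    = t-chained c

    bad : Bad δ (cycle δ zero)
    bad = (π δ iₗ , x∈p∩q⁺ (∈-cycle-π δ last∈ , ∈P {δ = δ} π-last-one)) ,
          orientation⇒sgnᶜ δ zero t orient , t , orient , positive
      where
      last∈ : iₗ ∈ cycle δ zero
      last∈ = subst (_∈ cycle δ zero) π-first (∈-cycle⁺ δ zero 1)

    none : ∀ {C} → ¬ Arrow δ C (cycle δ zero)
    none (_ , _ , _ , _ , t′ , (orient′ , positive′) , i , j , _ , j∈ , i<j , t′j≡+)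
      with x∈p∩q⁻ _ (Z δ) j∈
    ... | j∈D , j∈Z with ∈D j∈D
    ... | inj₂ (start refl) = contradiction i<j λ ()
    ... | inj₂ (inner _ e _) with () ← trans (sym e) (∈Z⁻ {δ = δ} j∈Z)
    none (_ , _ , _ , _ , t′ , (orient′ , positive′) , i , j , _ , j∈ , i<j , t′j≡+) | j∈D , j∈Z | inj₁ refl
      with () ← trans (sym (positive′ (π δ iₗ) (x∈p∩q⁺ (∈-cycle-π δ j∈D , ∈P {δ = δ} π-last-one))))
                  (trans (orient′ iₗ j∈D) (cong₂ Sign._*_ (sgn-false δ last0) t′j≡+))

  -- An arrow into the cycle would have to use one of its two zeros. The first point has nothing
  -- before it, and the last is negative in every bad orientation because its image is a one.
  chain⇒fails : ¬ Condition* δ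
  chain⇒fails = unreachable⇒fails zero bad none

-- The unreached cycle with the longest run

Run : ∀ {g} → Word g → Fin g → ℕ → Set
Run δ x zero    = ⊤
Run δ x (suc k) = lookup δ x ≡ true × Run δ (π δ x) k

run? : ∀ {g} (δ : Word g) x k → Dec (Run δ x k)
run? δ x zero    = yes tt
run? δ x (suc k) = (lookup δ x Bool.≟ true) ×-dec run? δ (π δ x) k

run-≤ : ∀ {g} (δ : Word g) {m n x} → m ≤ n → Run δ x n → Run δ x m
run-≤ δ z≤n     r       = tt
run-≤ δ (s≤s p) (e , r) = e , run-≤ δ p r

run-at : ∀ {g} (δ : Word g) {m n x} → m < n → Run δ x n → lookup δ ((π δ ^^ m) x) ≡ true
run-at δ {zero}  (s≤s _) (e , r) = e
run-at δ {suc m} {x = x} (s≤s p) (e , r) = trans (cong (lookup δ) (sym (^^-shift (π δ) m x))) (run-at δ p r)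

run-snoc : ∀ {g} (δ : Word g) n {x} → Run δ x n → lookup δ ((π δ ^^ n) x) ≡ true → Run δ x (suc n)
run-snoc δ zero    r       e = e , tt
run-snoc δ (suc n) {x} (e₀ , r) e = e₀ , run-snoc δ n r (trans (cong (lookup δ) (^^-shift (π δ) n x)) e)

π-descends : ∀ {n} (δ : Word (suc n)) {i} → lookup δ zero ≡ false → lookup δ i ≡ true → toℕ (π δ i) < toℕ i
π-descends δ {i} first0 e = ≤-trans (≤-reflexive (trans (cong suc (π-one δ i e)) (suc-pred-φ (1≤φ δ e)))) (φ≤toℕ δ i first0)
  where
  suc-pred-φ : ∀ {m} → 1 ≤ m → suc (pred m) ≡ m
  suc-pred-φ (s≤s _) = refl
  φ≤toℕ : ∀ {n} (δ : Word (suc n)) i → lookup δ zero ≡ false → φ δ i ≤ toℕ i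
  φ≤toℕ (false ∷ δ) zero    refl = z≤n
  φ≤toℕ (false ∷ δ) (suc i) refl = φ≤ δ i

-- With a zero in front, each step from a one strictly lowers the position. This is what guarantees
-- that a longest run exists.
run-bound : ∀ {n} (δ : Word (suc n)) {k x} → lookup δ zero ≡ false → Run δ x k → k ≤ toℕ x
run-bound δ {zero}  first0 r       = z≤n
run-bound δ {suc k} first0 (e , r) = <-≤-trans (s≤s (run-bound δ first0 r)) (π-descends δ first0 e)

-- Points with a run of ones behind them

Back : ∀ {g} → Word g → ℕ → Fin g → Set
Back δ k x = ∃ λ v → Run δ v k × (π δ ^^ k) v ≡ x

back-step : ∀ {g} (δ : Word g) k {x} → Back δ k x → lookup δ x ≡ true → Back δ (suc k) (π δ x)
back-step δ k (v , r , refl) e = v , run-snoc δ k r e , refl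

-- A point not after the image of a one is itself the image of a one, and `π` increases on ones;
-- induction on `k` then moves the comparison one step back.
back-≤ : ∀ {g} (δ : Word g) k {x y} → toℕ x ≤ toℕ y → Back δ k y → Back δ k x
back-≤ δ zero    {x} x≤y _ = x , tt , refl
back-≤ {g} δ (suc k) {x} x≤y (v , r , refl) =
  subst (Back δ (suc k)) (πOrbit.f∘f⁻¹ δ x) (back-step δ k (back-≤ δ k x₁≤y₁ (v , run-≤ δ (n≤1+n k) r , refl)) one)
  where
  x₁ y₁ : Fin g
  x₁ = πOrbit.f⁻¹ δ x
  y₁ = (π δ ^^ k) v
  y₁-one : lookup δ y₁ ≡ true
  y₁-one = run-at δ {k} ≤-refl r
  πx₁≤πy₁ : toℕ (π δ x₁) ≤ toℕ (π δ y₁)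
  πx₁≤πy₁ = subst (λ z → toℕ z ≤ toℕ (π δ y₁)) (sym (πOrbit.f∘f⁻¹ δ x)) x≤y
  one : lookup δ x₁ ≡ true
  one with true⊎false (lookup δ x₁)
  ... | inj₁ e = e
  ... | inj₂ e = contradiction πx₁≤πy₁ (<⇒≱ (π-one-zero δ y₁-one e))
  x₁≤y₁ : toℕ x₁ ≤ toℕ y₁
  x₁≤y₁ with toℕ x₁ ≤? toℕ y₁
  ... | yes p = p
  ... | no ¬p = contradiction πx₁≤πy₁ (<⇒≱ (π-one-mono δ y₁-one one (≰⇒> ¬p)))

nth-one : ∀ w h {n} → n < ones (take h w) → ∃ λ q → q < h × (∃ λ s → drop q w ≡ true ∷ s) × ones (take q w) ≡ n
nth-one (true ∷ w)  (suc h) {zero}  _       = 0 , s≤s z≤n , (w , refl) , refl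
nth-one (true ∷ w)  (suc h) {suc n} (s≤s p) with nth-one w h p
... | q , q<h , one , e = suc q , s≤s q<h , one , cong suc e
nth-one (false ∷ w) (suc h)         p       with nth-one w h p
... | q , q<h , one , e = suc q , s≤s q<h , one , e

module _ {g : ℕ} (δ : Word g) (D : Subset g)
         (closed : ∀ {y} → y ∈ D → π δ y ∈ D) (coclosed : ∀ {y} → π δ y ∈ D → y ∈ D) where

  one-off : ∀ {x} → x ∉ D → (∃ λ s → drop (rank D x) (off δ D) ≡ true ∷ s) → lookup δ x ≡ true
  one-off x∉ (s , e) with off-at δ D x∉
  ... | s′ , e′ = ∷-injectiveˡ (trans (sym e′) e)

  -- Heights are computed from the remaining word alone. This turns them into actual runs of `δ`,
  -- which can be used to produce arrows.
  back-rank : ∀ k {n} → n < height (off δ D) k → ∃ λ x → x ∉ D × rank D x ≡ n × Back δ k x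
  back-rank zero    n< with rank-surjective δ D n<
  ... | x , x∉ , e = x , x∉ , e , x , tt , refl
  back-rank (suc k) n< with nth-one (off δ D) (height (off δ D) k) n<
  ... | q , q< , one , e with back-rank k q<
  ... | x , x∉ , refl , bk = π δ x , x∉ ∘ coclosed ,
    trans (rank-π-one δ D (λ i → lookup-⇔ D coclosed closed) (one-off x∉ one)) e ,
    back-step δ k bk (one-off x∉ one)

  back-one : ∀ k → 0 < height (off δ D) (suc k) → ∃ λ x → x ∉ D × lookup δ x ≡ true × Back δ k x
  back-one k pos with nth-one (off δ D) (height (off δ D) k) pos
  ... | q , q< , one , _ with back-rank k q<
  ... | x , x∉ , refl , bk = x , x∉ , one-off x∉ one , bk

-- Reading the runs along a bad cycle

cols₂ : List ℕ → List Bool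
cols₂ []       = []
cols₂ (x ∷ xs) = replicate x true ++ false ∷ false ∷ cols₂ xs

module _ {g : ℕ} (δ : Word g) (D : Subset g) (t : Vec Sign g)
         (closed : ∀ {y} → y ∈ D → π δ y ∈ D)
         (orient : ∀ {i} → i ∈ D → lookup t (π δ i) ≡ sgn δ i Sign.* lookup t i)
         (positive : ∀ {i} → i ∈ D → lookup δ i ≡ true → lookup t i ≡ Sign.+) where

  after-one : ∀ {y} → y ∈ D → lookup δ y ≡ true → lookup t (π δ y) ≡ Sign.+
  after-one y∈ e = trans (orient y∈) (cong₂ Sign._*_ (sgn-true δ e) (positive y∈ e))

  after-zero : ∀ {y s} → y ∈ D → lookup δ y ≡ false → lookup t y ≡ s → lookup t (π δ y) ≡ Sign.opposite s
  after-zero y∈ e refl = trans (orient y∈) (cong (Sign._* _) (sgn-false δ e))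

  negative-zero : ∀ {y} → y ∈ D → lookup t y ≡ Sign.- → lookup δ y ≡ false
  negative-zero {y} y∈ e with true⊎false (lookup δ y)
  ... | inj₂ e′ = e′
  ... | inj₁ e′ with () ← trans (sym e) (positive y∈ e′)

  module _ (x₀ : Fin g) (b : ℕ)
           (short : ∀ {y} → y ∈ D → ¬ Run δ y (suc b))
           (x₀-one : lookup δ x₀ ≡ true)
           (before : ∀ {y} → y ∈ D → π δ y ≡ x₀ → lookup δ y ≡ false) where

    run-≤b : ∀ {y k} → y ∈ D → Run δ y k → k ≤ b
    run-≤b {y} {k} y∈ r with k ≤? b
    ... | yes p = p
    ... | no ¬p = contradiction (run-≤ δ (≰⇒> ¬p) r) (short y∈)

    -- Since t is positive on ones, the zeros on a bad cycle come in consecutive pairs with signs + and −.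
    parse : ∀ m {y} → y ∈ D → lookup t y ≡ Sign.+ → (π δ ^^ m) y ≡ x₀ →
            m ≡ 0 ⊎ ∃₂ λ k α → orbitWord δ y m ≡ cols₂ (k ∷ α) × All (_≤ b) α ×
                                Run δ y k × lookup δ ((π δ ^^ k) y) ≡ false
    parse zero y∈ ty end = inj₁ refl
    parse (suc m) {y} y∈ ty end with true⊎false (lookup δ y)
    ... | inj₁ e with parse m (closed y∈) (after-one y∈ e) (trans (^^-shift (π δ) m y) end)
    ...   | inj₁ refl with () ← trans (sym e) (before y∈ end)
    ...   | inj₂ (k , α , word , α≤ , r , e₀) =
      inj₂ (suc k , α , cong₂ _∷_ e word , α≤ , (e , r) , trans (cong (lookup δ) (sym (^^-shift (π δ) k y))) e₀)
    parse (suc zero) {y} y∈ ty refl | inj₂ e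
      with () ← trans (sym x₀-one) (negative-zero (closed y∈) (after-zero y∈ e ty))
    parse (suc (suc m)) {y} y∈ ty end | inj₂ e
      with negative-zero (closed y∈) (after-zero y∈ e ty)
    ... | e′ with parse m (closed (closed y∈)) (after-zero (closed y∈) e′ (after-zero y∈ e ty))
                    (trans (trans (^^-shift (π δ) m (π δ y)) (cong (π δ) (^^-shift (π δ) m y))) end)
    ...   | inj₁ refl = inj₂ (0 , [] , cong₂ _∷_ e (cong (_∷ []) e′) , [] , tt , e)
    ...   | inj₂ (k , α , word , α≤ , r , _) =
      inj₂ (0 , k ∷ α , cong₂ _∷_ e (cong₂ _∷_ e′ word) , run-≤b (closed (closed y∈)) r ∷ α≤ , tt , e)

greatest : {Q : ℕ → Set} → (∀ n → Dec (Q n)) → ∀ m → Q 1 → ¬ Q (suc m) → ∃ λ b → Q (suc b) × ¬ Q (suc (suc b))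
greatest Q? zero    q₁ ¬q = contradiction q₁ ¬q
greatest Q? (suc m) q₁ ¬q with Q? (suc m)
... | yes q  = m , q , ¬q
... | no ¬q′ = greatest Q? m q₁ ¬q′

-- The bound off `D` is weaker by one than that on `D`: the positive zero ending the front run has
-- `b` ones behind it, so only a one with `suc b` ones behind it is sure to precede that zero.
record Code {n : ℕ} (δ : Word (suc n)) (b : ℕ) (α a : List ℕ) : Set where
  field
    {D}    : Subset (suc n)
    {x₀}   : Fin (suc n)
    {len}  : ℕ
    orbit  : IsOrbit δ x₀ D len
    word   : orbitWord δ x₀ (suc len) ≡ cols₂ (b ∷ α)
    α≤     : All (_≤ b) α
    rest   : off δ D ≡ build (suc b) a
    a≤     : All (_≤ suc b) a

module _ {n : ℕ} (δ : Word (suc n)) (first0 : lookup δ zero ≡ false) where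

  FromGood : Subset (suc n) → Set
  FromGood C = ∃ λ j → Good δ (cycle δ j) × Star (Arrow δ) (cycle δ j) C

  abstract
    badᵈ : ∀ C → Dec (Bad δ C)
    badᵈ = bad? δ

    pathᵈ : ∀ C C′ → Dec (Star (Arrow δ) C C′)
    pathᵈ = path? δ

  fromGood? : ∀ C → Dec (FromGood C)
  fromGood? C = any? λ j → ¬? (badᵈ (cycle δ j)) ×-dec pathᵈ (cycle δ j) C

  unreached : ¬ Condition* δ → ∃ λ c → Bad δ (cycle δ c) × ¬ FromGood (cycle δ c)
  unreached fails = split (¬∀⟶∃¬ (suc n) _ (λ i → badᵈ (cycle δ i) →-dec fromGood? (cycle δ i)) (fails ∘ condition))
    where
    condition : (∀ i → Bad δ (cycle δ i) → FromGood (cycle δ i)) → Condition* δ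
    condition all _ (i , refl) bad = let j , good , path = all i bad in cycle δ j , (j , refl) , good , path
    split : (∃ λ c → ¬ (Bad δ (cycle δ c) → FromGood (cycle δ c))) → ∃ λ c → Bad δ (cycle δ c) × ¬ FromGood (cycle δ c)
    split (c , ¬imp) = c ,
      decidable-stable (badᵈ (cycle δ c)) (λ ¬bad → ¬imp (λ bad → contradiction bad ¬bad)) ,
      λ fg → ¬imp (λ _ → fg)

  module _ (C₀ : Subset (suc n)) (¬good : ¬ FromGood C₀) where

    private
      U : Fin (suc n) → Set
      U x = Star (Arrow δ) (cycle δ x) C₀

      U-cycle : ∀ {x y} → y ∈ cycle δ x → U x → U y
      U-cycle y∈ u = subst (λ C → Star (Arrow δ) C C₀) (sym (cycle-≡ δ y∈)) u

      U-bad : ∀ {x} → U x → Bad δ (cycle δ x)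
      U-bad {x} u = decidable-stable (badᵈ (cycle δ x)) (λ good → ¬good (x , good , u))

      HasRun : ℕ → Set
      HasRun k = ∃ λ x → U x × Run δ x k

      hasRun? : ∀ k → Dec (HasRun k)
      hasRun? k = any? λ x → pathᵈ (cycle δ x) C₀ ×-dec run? δ x k

      noLongRun : ¬ HasRun (suc n)
      noLongRun (x , _ , r) = <⇒≱ (toℕ<n x) (run-bound δ first0 r)

      module Longest (b : ℕ) (short : ∀ {y} → U y → ¬ Run δ y (suc (suc b))) (x₀ : Fin (suc n)) (u : U x₀)
                     (r₀ : Run δ x₀ (suc b)) (D : Subset (suc n)) (D≡ : D ≡ cycle δ x₀) (t : Vec Sign (suc n))
                     (badOrient : IsBadOrientation δ D t) {N : ℕ} (orb : IsOrbit δ x₀ D N) where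

        module O = IsOrbit orb

        x₀∈ : x₀ ∈ D
        x₀∈ = O.member 0

        U-D : ∀ {y} → y ∈ D → U y
        U-D {y} y∈ = U-cycle (subst (y ∈_) D≡ y∈) u

        orient : ∀ {i} → i ∈ D → lookup t (π δ i) ≡ sgn δ i Sign.* lookup t i
        orient {i} = proj₁ badOrient i

        positive : ∀ {i} → i ∈ D → lookup δ i ≡ true → lookup t i ≡ Sign.+
        positive {i} i∈ e = proj₂ badOrient i (x∈p∩q⁺ (i∈ , ∈P {δ = δ} e))

        before : ∀ {y} → y ∈ D → π δ y ≡ x₀ → lookup δ y ≡ false
        before {y} y∈ refl with true⊎false (lookup δ y)
        ... | inj₂ e = e
        ... | inj₁ e = contradiction (e , r₀) (short (U-D y∈))

        j : Fin (suc n)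
        j = (π δ ^^ suc b) x₀

        j∈ : j ∈ D
        j∈ = O.member (suc b)

        j-zero : lookup δ j ≡ false
        j-zero with true⊎false (lookup δ j)
        ... | inj₂ e = e
        ... | inj₁ e = contradiction (run-snoc δ (suc b) r₀ e) (short u)

        j-positive : lookup t j ≡ Sign.+
        j-positive = after-one δ D t O.closed orient positive (O.member b) (run-at δ {b} ≤-refl r₀)

        unback : ∀ k {v} → (π δ ^^ k) v ∈ D → v ∈ D
        unback zero    v∈ = v∈
        unback (suc k) v∈ = unback k (O.coclosed v∈)

        bad : Bad δ D
        bad = subst (Bad δ) (sym D≡) (U-bad u)

        -- A longer run off D would give an arrow into D from the cycle carrying it.
        no-back : ∀ {x v} → x ∉ D → lookup δ x ≡ true → Run δ v (suc (suc b)) → ¬ (π δ ^^ suc (suc b)) v ≡ x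
        no-back {x} {v} x∉ e r eq = short (U-cycle v∈ (arrow ◅ subst (λ C → Star (Arrow δ) C C₀) (sym D≡) u)) r
          where
          v∈ : v ∈ cycle δ x
          v∈ = ∈-cycle-sym δ (subst (_∈ cycle δ v) eq (∈-cycle⁺ δ v (suc (suc b))))
          -- If `j` were at or before `x`, it too would have `suc (suc b)` ones behind it, and that
          -- run would lie on `D`.
          x<j : toℕ x < toℕ j
          x<j = ≰⇒> λ j≤x → let w , rw , eqw = back-≤ δ (suc (suc b)) {j} j≤x (v , r , eq)
                            in short (U-D (unback (suc (suc b)) (subst (_∈ D) (sym eqw) j∈))) rw
          arrow : Arrow δ (cycle δ x) D
          arrow = (x , refl) , (x₀ , D≡) , (λ eqC → x∉ (subst (x ∈_) eqC (∈-cycle-self δ x))) , bad ,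
                  t , badOrient , x , j , x∈p∩q⁺ (∈-cycle-self δ x , ∈P {δ = δ} e) ,
                  x∈p∩q⁺ (j∈ , x∉p⇒x∈∁p (λ j∈P → contradiction (trans (sym (∈P⁻ {δ = δ} j∈P)) j-zero) λ ())) ,
                  x<j , j-positive

        -- Here the longest run has length `suc b`; a positive height would give a one off `D` with
        -- `suc (suc b)` ones behind it.
        height-off : height (off δ D) (suc (suc (suc b))) ≡ 0
        height-off = n≤0⇒n≡0 (≮⇒≥ λ pos →
          let x , x∉ , e , v , r , eq = back-one δ D O.closed O.coclosed (suc (suc b)) pos
          in no-back x∉ e r eq)

        code : ∃₂ λ α a → Code δ (suc b) α a
        code = assemble
          (parse δ D t O.closed orient positive x₀ (suc b) (λ y∈ → short (U-D y∈)) (proj₁ r₀) before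
            (suc N) x₀∈ (positive x₀∈ (proj₁ r₀)) O.period)
          (build-surjective (suc (suc b)) (off δ D) height-off)
          where
          Parsed : Set
          Parsed = suc N ≡ 0 ⊎ ∃₂ λ k α → orbitWord δ x₀ (suc N) ≡ cols₂ (k ∷ α) × All (_≤ suc b) α ×
                                          Run δ x₀ k × lookup δ ((π δ ^^ k) x₀) ≡ false
          assemble : Parsed → (∃ λ a → All (_≤ suc (suc b)) a × build (suc (suc b)) a ≡ off δ D) →
                     ∃₂ λ α a → Code δ (suc b) α a
          assemble (inj₂ (k , α , word , α≤ , r , e₀)) (a , a≤ , e) = α , a , record
            { orbit = orb ; word = subst (λ k → orbitWord δ x₀ (suc N) ≡ cols₂ (k ∷ α)) k≡b word
            ; α≤ = α≤ ; rest = sym e ; a≤ = a≤ }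
            where
            k≡b : k ≡ suc b
            k≡b = ≤-antisym (≮⇒≥ λ b<k → short u (run-≤ δ b<k r))
              (≮⇒≥ λ k<b → contradiction (trans (sym (run-at δ k<b r₀)) e₀) λ ())

    unreached⇒code : ∀ c → C₀ ≡ cycle δ c → Bad δ C₀ → ∃ λ b → ∃₂ λ α a → Code δ b α a
    unreached⇒code c refl ((i , i∈) , _) =
      -- A bad cycle contains a one, and this supplies the initial run of length 1.
      longest (greatest hasRun? n (i , U-cycle (proj₁ (x∈p∩q⁻ _ (P δ) i∈)) ε , ∈P⁻ {δ = δ} (proj₂ (x∈p∩q⁻ _ (P δ) i∈)) , tt) noLongRun)
      where
      longest : (∃ λ b → HasRun (suc b) × ¬ HasRun (suc (suc b))) → ∃ λ b → ∃₂ λ α a → Code δ b α a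
      longest (b , (x₀ , u , r₀) , ¬longer) =
        let _ , _ , t , bo = U-bad u
            _ , orb        = cycle-isOrbit δ x₀
        in suc b , Longest.code b (λ {y} uy r → ¬longer (y , uy , r)) x₀ u r₀ (cycle δ x₀) refl t bo orb

  fails⇒code : ¬ Condition* δ → ∃ λ b → ∃₂ λ α a → Code δ b α a
  fails⇒code fails =
    let c , bad , ¬fg = unreached fails
    in unreached⇒code (cycle δ c) ¬fg c refl bad

-- The two injections

toVec : ∀ {A : Set} {n} (l : List A) → length l ≡ n → ∃ λ (v : Vec A n) → toList v ≡ l
toVec []      refl = [] , refl
toVec (x ∷ l) refl with toVec l refl
... | v , e = x ∷ v , cong (x ∷_) e

toList-inj : ∀ {A : Set} {n} {u v : Vec A n} → toList u ≡ toList v → u ≡ v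
toList-inj {u = []}    {[]}    _ = refl
toList-inj {u = x ∷ u} {y ∷ v} e with ∷-injective e
... | refl , e′ = cong (x ∷_) (toList-inj e′)

length-words : ∀ n → length (words n) ≡ 2 ^ n
length-words zero    = refl
length-words (suc n) = trans (length-++ (map (false ∷_) (words n)))
  (cong₂ _+_ (trans (length-map _ (words n)) (length-words n))
    (trans (length-++ (map (true ∷_) (words n))) (cong (_+ 0) (trans (length-map _ (words n)) (length-words n)))))

words-unique : ∀ n → Unique (words n)
words-unique zero    = [] ∷ []
words-unique (suc n) = cartesianProductWith⁺ _∷_ (λ { refl → refl , refl }) (((λ ()) ∷ []) ∷ ([] ∷ [])) (words-unique n)

∈-words : ∀ {n} (v : Word n) → v ∈ˡ words n
∈-words = vecs-complete _ λ { false → here refl ; true → there (here refl) }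

-- Counting the failing words

length-filter-map : ∀ {A B : Set} {Q : B → Set} (Q? : ∀ y → Dec (Q y)) (h : A → B) xs →
                    length (filter Q? (map h xs)) + length (filter (¬? ∘ Q? ∘ h) xs) ≡ length xs
length-filter-map Q? h []       = refl
length-filter-map Q? h (x ∷ xs) with Q? (h x)
... | yes _ = cong suc (length-filter-map Q? h xs)
... | no  _ = trans (+-suc _ _) (cong suc (length-filter-map Q? h xs))

length-filter-words : ∀ {n} {Q : Word (suc n) → Set} (Q? : ∀ v → Dec (Q v)) → (∀ v → ¬ Q (true ∷ v)) →
                      length (filter Q? (words (suc n))) + length (filter (¬? ∘ Q? ∘ (false ∷_)) (words n)) ≡ 2 ^ n
length-filter-words {n} Q? none = begin
  length (filter Q? (xs ++ ys ++ [])) + c            ≡⟨ cong (λ l → length l + c) (filter-++ Q? xs _) ⟩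
  length (filter Q? xs ++ filter Q? (ys ++ [])) + c  ≡⟨ cong (λ l → length (filter Q? xs ++ l) + c) (filter-none Q? none-ys) ⟩
  length (filter Q? xs ++ []) + c                    ≡⟨ cong (λ l → length l + c) (++-identityʳ (filter Q? xs)) ⟩
  length (filter Q? xs) + c                          ≡⟨ length-filter-map Q? (false ∷_) (words n) ⟩
  length (words n)                                   ≡⟨ length-words n ⟩
  2 ^ n                                              ∎
  where
  open ≡-Reasoning
  xs = map (false ∷_) (words n)
  ys = map (true ∷_) (words n)
  c = length (filter (¬? ∘ Q? ∘ (false ∷_)) (words n))
  none-ys : All (λ v → ¬ _) (ys ++ [])
  none-ys = All.++⁺ (All.map⁺ (All.universal none (words n))) []

abstract
  failing : ∀ n → List (Word n)
  failing n = filter (¬? ∘ condition*? ∘ (false ∷_)) (words n)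

  failing-unique : ∀ n → Unique (failing n)
  failing-unique n = filter⁺ (¬? ∘ condition*? ∘ (false ∷_)) (words-unique n)

  ∈-failing⁺ : ∀ {n} {δ : Word n} → ¬ Condition* (false ∷ δ) → δ ∈ˡ failing n
  ∈-failing⁺ {δ = δ} = ∈-filter⁺ (¬? ∘ condition*? ∘ (false ∷_)) (∈-words δ)

  ∈-failing⁻ : ∀ {n} {δ : Word n} → δ ∈ˡ failing n → ¬ Condition* (false ∷ δ)
  ∈-failing⁻ {n} δ∈ = proj₂ (∈-filter⁻ (¬? ∘ condition*? ∘ (false ∷_)) {xs = words n} δ∈)

  N+failing : ∀ n → N (suc n) + length (failing n) ≡ 2 ^ n
  N+failing n = length-filter-words {n} condition*? one∷-fails

-- The first zero of each pair 00 on D becomes a one, so that the extra zero marks the end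
-- of D; one more one makes the front run longer than the runs b + 1 allowed off D.
codeword : ℕ → List ℕ → List ℕ → List ℕ
codeword b α a = (2 + b) ∷ map suc α ++ 0 ∷ a

-- The entries of `map suc α` are positive, so the first `0` shows where `a` begins.
codeword-injective : ∀ {b α a b′ α′ a′} → codeword b α a ≡ codeword b′ α′ a′ → b ≡ b′ × α ≡ α′ × a ≡ a′
codeword-injective {α = α} {α′ = α′} e with ∷-injective e
... | refl , e′ with split α α′ e′
  where
  split : ∀ α α′ {a a′} → map suc α ++ 0 ∷ a ≡ map suc α′ ++ 0 ∷ a′ → α ≡ α′ × a ≡ a′
  split []      []       refl = refl , refl
  split []      (_ ∷ _)  ()
  split (_ ∷ _) []       ()
  split (x ∷ α) (y ∷ α′) e with ∷-injective e
  ... | refl , e′ with split α α′ e′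
  ... | refl , e″ = refl , e″
... | eα , ea = refl , eα , ea

length-cols₂ : ∀ xs → length (cols₂ xs) ≡ total (map suc xs)
length-cols₂ []       = refl
length-cols₂ (x ∷ xs) = begin
  length (replicate x true ++ false ∷ false ∷ cols₂ xs)       ≡⟨ length-++ (replicate x true) ⟩
  length (replicate x true) + suc (suc (length (cols₂ xs)))   ≡⟨ cong₂ _+_ (length-replicate x) (cong (λ m → suc (suc m)) (length-cols₂ xs)) ⟩
  x + suc (suc (total (map suc xs)))                               ≡⟨ trans (+-suc x _) (cong suc (+-suc x _)) ⟩
  suc (suc (x + total (map suc xs)))                               ∎
  where open ≡-Reasoning

length-orbitWord : ∀ {g} (δ : Word g) x n → length (orbitWord δ x n) ≡ n
length-orbitWord δ x n = trans (length-map (lookup δ) (iterate (π δ) x n)) (length-iterate (π δ) x n)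

module _ {n : ℕ} {δ : Word (suc n)} {b α a} (code : Code δ b α a) where
  open Code code

  -- Turning `00` into `10` keeps the length; the two extra letters are the one added to the front
  -- run and the separating zero.
  total-codeword : total (codeword b α a) ≡ 2 + suc n
  total-codeword = begin
    3 + (b + total (map suc α ++ 0 ∷ a))              ≡⟨ cong (λ m → 3 + (b + m)) (total-++ (map suc α)) ⟩
    3 + (b + (total (map suc α) + suc (total a)))     ≡⟨ cong (_+_ 3) (trans (sym (+-assoc b _ _)) (+-suc _ (total a))) ⟩
    2 + (2 + (b + total (map suc α)) + total a)       ≡⟨ cong (λ m → 2 + (m + total a)) (sym (length-cols₂ (b ∷ α))) ⟩
    2 + (length (cols₂ (b ∷ α)) + total a)            ≡⟨ cong₂ (λ u v → 2 + (length u + v)) (sym word) (sym (length-build (suc b) a≤)) ⟩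
    2 + (length (orbitWord δ x₀ (suc len)) + length (build (suc b) a))
      ≡⟨ cong₂ (λ u v → 2 + (u + length v)) (length-orbitWord δ x₀ (suc len)) (sym rest) ⟩
    2 + (suc len + length (off δ D))                  ≡⟨ cong (_+_ 2) (length-cycle+off δ x₀ D orbit) ⟩
    2 + suc n                                         ∎
    where open ≡-Reasoning

  codeword-front : StrictFront (codeword b α a)
  codeword-front = All.++⁺ (All.map⁺ (All.map (λ x≤b → s≤s (s≤s x≤b)) α≤)) (s≤s z≤n ∷ All.map (λ x≤ → s≤s x≤) a≤)

code-injective : ∀ {n} {δ δ′ : Word (suc n)} {b α a} → Code δ b α a → Code δ′ b α a → δ ≡ δ′
code-injective {δ = δ} {δ′} {b} {α} c c′ with Code.len c | Code.orbit c | Code.word c | Code.len c′ | Code.orbit c′ | Code.word c′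
... | l | orb | w | l′ | orb′ | w′
  with suc-injective (trans (sym (length-orbitWord δ (Code.x₀ c) (suc l))) (trans (cong length (trans w (sym w′))) (length-orbitWord δ′ (Code.x₀ c′) (suc l′))))
... | refl = orbitWord-off-injective orb orb′ (trans w (sym w′)) (trans (Code.rest c) (sym (Code.rest c′)))

-- The upper bound: rotations of codewords

module Upper (n : ℕ) where

  -- The Boolean summand indexes the two constant words.
  Index : Set
  Index = Bool ⊎ (ℕ × Word n)

  _~_ : Index → Word (2 + suc n) → Set
  inj₁ c       ~ w = All (_≡ c) (toList w)
  inj₂ (i , δ) ~ w = ∃ λ b → ∃₂ λ α a → Code (false ∷ δ) b α a × Rotation i (cols (codeword b α a)) (toList w)

  not-constant : ∀ b α a {c i x} → All (_≡ c) x → ¬ Rotation i (cols (codeword b α a)) x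
  not-constant b α a {c} all (u , v , e , refl , _ , _) with subst (All (_≡ c)) (sym e) (All.++⁺ (All.++⁻ʳ v all) (All.++⁻ˡ v all))
  ... | refl ∷ all′ with All.++⁻ʳ (replicate (suc b) true) all′
  ... | () ∷ _

  ~-injective : ∀ {i i′ w} → i ~ w → i′ ~ w → i ≡ i′
  ~-injective {inj₁ c} {inj₁ d} {x ∷ w} (p ∷ _) (q ∷ _) = cong inj₁ (trans (sym p) q)
  ~-injective {inj₁ c} {inj₂ _} p (b , α , a , _ , rot) = contradiction rot (not-constant b α a p)
  ~-injective {inj₂ _} {inj₁ c} (b , α , a , _ , rot) p = contradiction rot (not-constant b α a p)
  ~-injective {inj₂ (i , δ)} {inj₂ (i′ , δ′)} (b , α , a , code , rot) (b′ , α′ , a′ , code′ , rot′)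
    with rotation-injective (codeword-front code) (codeword-front code′) rot rot′
  ... | refl , e with codeword-injective e
  ... | refl , refl , refl with code-injective code code′
  ... | refl = refl

  indices : List Index
  indices = map inj₁ (false ∷ true ∷ []) ++ map inj₂ (cartesianProduct (upTo (2 + suc n)) (failing n))

  indices-unique : Unique indices
  indices-unique = ++⁺ (map⁺ inj₁-injective (((λ ()) ∷ []) ∷ ([] ∷ [])))
    (map⁺ inj₂-injective (cartesianProduct⁺ (upTo⁺ (2 + suc n)) (failing-unique n)))
    λ { (here refl , q) → disjoint q ; (there (here refl) , q) → disjoint q }
    where
    disjoint : ∀ {c : Bool} {ps : List (ℕ × Word n)} → ¬ _∈ˡ_ {A = Index} (inj₁ c) (map inj₂ ps)
    disjoint q with ∈-map⁻ inj₂ q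
    ... | _ , _ , ()

  rotated : ∀ {i δ} → i < 2 + suc n → (∃ λ b → ∃₂ λ α a → Code (false ∷ δ) b α a) →
            ∃ λ w → w ∈ˡ words (2 + suc n) × inj₂ (i , δ) ~ w
  rotated {i} i< (b , α , a , code) = proj₁ w , ∈-words (proj₁ w) , b , α , a , code ,
    (take i l , drop i l , sym (take++drop≡id i l) , proj₂ w , length-u , 0<v)
    where
    l = cols (codeword b α a)
    length-l : length l ≡ 2 + suc n
    length-l = trans (length-cols (codeword b α a)) (total-codeword code)
    length-u : length (take i l) ≡ i
    length-u = trans (length-take i l) (m≤n⇒m⊓n≡m (≤-trans (<⇒≤ i<) (≤-reflexive (sym length-l))))
    0<v : 0 < length (drop i l)
    0<v = subst (0 <_) (sym (trans (length-drop i l) (cong (_∸ i) length-l))) (m<n⇒0<n∸m i<)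
    w : ∃ λ (w : Word (2 + suc n)) → toList w ≡ drop i l ++ take i l
    w = toVec (drop i l ++ take i l) (begin
      length (drop i l ++ take i l)          ≡⟨ length-++ (drop i l) ⟩
      length (drop i l) + length (take i l)  ≡⟨ +-comm (length (drop i l)) _ ⟩
      length (take i l) + length (drop i l)  ≡⟨ length-++ (take i l) ⟨
      length (take i l ++ drop i l)          ≡⟨ cong length (take++drop≡id i l) ⟩
      length l                               ≡⟨ length-l ⟩
      2 + suc n                              ∎)
      where open ≡-Reasoning

  ~-total : ∀ {i} → i ∈ˡ indices → ∃ λ w → w ∈ˡ words (2 + suc n) × i ~ w
  ~-total {inj₁ c} _ =
    let w , e = toVec (replicate (2 + suc n) c) (length-replicate _)
    in w , ∈-words w , subst (All (_≡ c)) (sym e) (All.replicate⁺ (2 + suc n) refl)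
  ~-total {inj₂ (i , δ)} (there (there i∈)) with ∈-map⁻ inj₂ i∈
  ... | _ , p , refl =
    let i< , δ∈ = ∈-cartesianProduct⁻ (upTo (2 + suc n)) (failing n) p
    in rotated (∈-upTo⁻ i<) (fails⇒code (false ∷ δ) refl (∈-failing⁻ δ∈))

length-pairs : ∀ {A B : Set} (xs : List A) (ys : List B) → length (cartesianProduct xs ys) ≡ length xs * length ys
length-pairs []       ys = refl
length-pairs (x ∷ xs) ys = trans (length-++ (map (x ,_) ys)) (cong₂ _+_ (length-map _ ys) (length-pairs xs ys))

upper-bound : ∀ n → 2 + (2 + suc n) * length (failing n) ≤ 2 ^ (2 + suc n)
upper-bound n = subst₂ _≤_
  (cong (_+_ 2) (trans (length-map inj₂ pairs) (trans (length-pairs (upTo (2 + suc n)) (failing n)) (cong (_* length (failing n)) (length-upTo (2 + suc n))))))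
  (length-words (2 + suc n))
  (length-≤ (Upper._~_ n) (Upper.indices-unique n) (Upper.~-total n) (Upper.~-injective n))
  where
  pairs = cartesianProduct (upTo (2 + suc n)) (failing n)

-- The lower bound: a longest run moved to the front

max-split : ∀ x xs → ∃₂ λ ys m → ∃ λ zs → x ∷ xs ≡ ys ++ m ∷ zs × All (_≤ m) (ys ++ zs)
max-split x []        = [] , x , [] , refl , []
max-split x (x′ ∷ xs) with max-split x′ xs
... | ys , m , zs , e , all with ≤-total x m
... | inj₁ x≤m = x ∷ ys , m , zs , cong (x ∷_) e , x≤m ∷ all
... | inj₂ m≤x = [] , x , x′ ∷ xs , refl ,
  subst (All (_≤ x)) (sym e) (All.++⁺ (All.++⁻ˡ ys all′) (m≤x ∷ All.++⁻ʳ ys all′))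
  where
  all′ : All (_≤ x) (ys ++ zs)
  all′ = All.map (λ y≤m → ≤-trans y≤m m≤x) all

build-last : ∀ k c → ∃ λ s → build k (c ∷ʳ 0) ≡ s ∷ʳ false
build-last zero    c = map (λ _ → false) c , map-++ (λ _ → false) c (0 ∷ [])
build-last (suc k) c = build k (dec (c ∷ʳ 0)) ++ map pos c ,
  trans (cong (build k (dec (c ∷ʳ 0)) ++_) (map-++ pos c (0 ∷ []))) (sym (++-assoc (build k (dec (c ∷ʳ 0))) (map pos c) _))

lookup-last : ∀ {n} (δ : Word (suc n)) {s} → toList δ ≡ s ∷ʳ false → lookup δ (fromℕ n) ≡ false
lookup-last {zero}  (x ∷ [])    {s}     e = ∷ʳ-injectiveʳ [] s e
lookup-last {suc n} (x ∷ y ∷ δ) {[]}    e with () ← ∷-injectiveʳ e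
lookup-last {suc n} (x ∷ δ)     {_ ∷ s} e = lookup-last δ (∷-injectiveʳ e)

cols-zeros : ∀ {l} → All (_≤ 0) l → All (_≡ false) (cols l)
cols-zeros []        = []
cols-zeros (z≤n ∷ h) = refl ∷ cols-zeros h

length≤total : ∀ xs → length xs ≤ total xs
length≤total []       = z≤n
length≤total (x ∷ xs) = s≤s (≤-trans (length≤total xs) (m≤n+m _ x))

module Lower (n : ℕ) where

  Index : Set
  Index = ⊤ ⊎ (ℕ × Word (suc n))

  total-split : ∀ (v : Word n) ys {m zs} → cols (ys ++ m ∷ zs) ≡ toList v ∷ʳ false → total (ys ++ m ∷ zs) ≡ suc n
  total-split v ys {m} {zs} split = begin
    total (ys ++ m ∷ zs)             ≡⟨ length-cols (ys ++ m ∷ zs) ⟨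
    length (cols (ys ++ m ∷ zs))     ≡⟨ cong length split ⟩
    length (toList v ∷ʳ false)       ≡⟨ length-++ (toList v) ⟩
    length (toList v) + 1            ≡⟨ cong (_+ 1) (length-toList v) ⟩
    n + 1                            ≡⟨ +-comm n 1 ⟩
    suc n                            ∎
    where open ≡-Reasoning

  -- Remembering the old place `i` of the run `m` makes the move reversible. The final `0` becomes
  -- the last letter of the built word, a zero as `chain⇒fails` requires. The level `suc (suc n)`
  -- bounds all entries and is the same for every `v`, so that `build-injective` applies.
  record Front (v : Word n) (i : ℕ) (δ : Word (suc n)) : Set where
    field
      ys zs  : List ℕ
      m      : ℕ
      split  : cols (ys ++ m ∷ zs) ≡ toList v ∷ʳ false
      at     : length ys ≡ i
      max    : All (_≤ m) (ys ++ zs)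
      built  : toList (false ∷ δ) ≡ build (suc (suc n)) (m ∷ (ys ++ zs) ∷ʳ 0)

  _~_ : Word n → Index → Set
  v ~ inj₁ _       = All (_≡ false) (toList v)
  v ~ inj₂ (i , δ) = Front v i δ

  -- A positive run with its closing zero takes at least two of the `suc n` letters, which leaves
  -- room for fewer than `n` runs before it. This gives the factor `n` in the bound.
  m-bound : ∀ ys m zs → total (ys ++ m ∷ zs) ≡ suc n → m ≤ n × (0 < m → length ys < n)
  m-bound ys m zs e = ≤-pred (≤-trans (≤-trans (s≤s (m≤m+n m (total zs))) (m≤n+m _ (total ys))) sum≤) ,
    λ 0<m → ≤-pred (≤-trans (≤-reflexive (+-comm 2 (length ys)))
      (≤-trans (+-mono-≤ (length≤total ys) (s≤s (≤-trans 0<m (m≤m+n m (total zs))))) sum≤))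
    where
    sum≤ : total ys + suc (m + total zs) ≤ suc n
    sum≤ = ≤-reflexive (trans (sym (total-++ ys)) e)

  ∷ʳ0-All : ∀ {m k ws} → m ≤ k → All (_≤ m) ws → All (_≤ k) (m ∷ ws ∷ʳ 0)
  ∷ʳ0-All m≤k h = m≤k ∷ All.++⁺ (All.map (λ x≤m → ≤-trans x≤m m≤k) h) (z≤n ∷ [])

  same : ∀ {u v : Word n} → All (_≡ false) (toList u) → All (_≡ false) (toList v) → u ≡ v
  same {u} {v} p q = toList-inj (go p q (trans (length-toList u) (sym (length-toList v))))
    where
    go : ∀ {k l : List Bool} → All (_≡ false) k → All (_≡ false) l → length k ≡ length l → k ≡ l
    go []         []         _ = refl
    go (refl ∷ p) (refl ∷ q) e = cong (false ∷_) (go p q (suc-injective e))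

  ~-injective : ∀ {u v i} → u ~ i → v ~ i → u ≡ v
  ~-injective {i = inj₁ _} p q = same p q
  ~-injective {u} {v} {i = inj₂ (i , δ)} p q
    with ∷-injective (build-injective (suc (suc n)) (bound p) (bound q) (trans (sym (Front.built p)) (Front.built q)))
    where
    bound : ∀ {v} (p : Front v i δ) → All (_≤ suc (suc n)) (Front.m p ∷ (Front.ys p ++ Front.zs p) ∷ʳ 0)
    bound {v} p = ∷ʳ0-All (m≤n⇒m≤1+n (m≤n⇒m≤1+n (proj₁ (m-bound ys m zs (total-split v ys split))))) max
      where open Front p
  ... | m≡ , e with ++-injective (Front.ys p) (Front.ys q) (∷ʳ-injectiveˡ (Front.ys p ++ Front.zs p) (Front.ys q ++ Front.zs q) e) (trans (Front.at p) (sym (Front.at q)))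
  ... | ys≡ , zs≡ = toList-inj (∷ʳ-injectiveˡ (toList u) (toList v)
    (trans (sym (Front.split p)) (trans (cong cols (cong₂ _++_ ys≡ (cong₂ _∷_ m≡ zs≡))) (Front.split q))))

  indices : List Index
  indices = inj₁ tt ∷ map inj₂ (cartesianProduct (upTo n) (failing (suc n)))

  ~-total : ∀ {v} → v ∈ˡ words n → ∃ λ i → i ∈ˡ indices × v ~ i
  ~-total {v} _ with cols-surjective (toList v)
  ... | x , xs , e with max-split x xs
  ... | ys , zero , zs , eq , all = inj₁ tt , here refl ,
    All.++⁻ˡ (toList v) (subst (All (_≡ false)) (trans (cong cols (sym eq)) e)
      (cols-zeros (All.++⁺ (All.++⁻ˡ ys all) (z≤n ∷ All.++⁻ʳ ys all))))
  ... | ys , m@(suc m′) , zs , eq , all = go (toVec (build g c) length-c)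
    where
    g = suc (suc n)
    c = m ∷ (ys ++ zs) ∷ʳ 0
    split : cols (ys ++ m ∷ zs) ≡ toList v ∷ʳ false
    split = trans (cong cols (sym eq)) e
    bounds = m-bound ys m zs (total-split v ys split)
    m≤g : m ≤ g
    m≤g = m≤n⇒m≤1+n (m≤n⇒m≤1+n (proj₁ bounds))
    all′ : All (_≤ m) ((ys ++ zs) ∷ʳ 0)
    all′ = All.++⁺ all (z≤n ∷ [])
    length-c : length (build g c) ≡ g
    length-c = begin
      length (build g c)                        ≡⟨ length-build g (∷ʳ0-All m≤g all) ⟩
      suc (m + total ((ys ++ zs) ∷ʳ 0))         ≡⟨ cong (λ k → suc (m + k)) (trans (total-++ (ys ++ zs)) (cong (_+ 1) (total-++ ys))) ⟩
      suc (m + (total ys + total zs + 1))       ≡⟨ cong suc (rearrange m (total ys) (total zs)) ⟩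
      suc (total ys + suc (m + total zs))       ≡⟨ cong suc (total-++ ys) ⟨
      suc (total (ys ++ m ∷ zs))                ≡⟨ cong suc (total-split v ys split) ⟩
      g                                         ∎
      where
      open ≡-Reasoning
      open +-*-Solver
      rearrange : ∀ m y z → m + (y + z + 1) ≡ y + suc (m + z)
      rearrange = solve 3 (λ m y z → m :+ (y :+ z :+ con 1) := y :+ (con 1 :+ (m :+ z))) refl
    go : (∃ λ (δ : Word g) → toList δ ≡ build g c) → ∃ λ i → i ∈ˡ indices × v ~ i
    go (b ∷ δ , e′) with build-head g m≤g all′ | build-last g (m ∷ (ys ++ zs))
    ... | s , head | s′ , last with ∷-injectiveˡ (trans e′ head)
    ... | refl = inj₂ (length ys , δ) ,
      there (∈-map⁺ inj₂ (∈-cartesianProduct⁺ (∈-upTo⁺ (proj₂ bounds (s≤s z≤n))) (∈-failing⁺ fails))) ,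
      record { ys = ys ; zs = zs ; m = m ; split = split ; at = refl ; max = all ; built = e′ }
      where
      ones-pos′ : 0 < ones (build g c)
      ones-pos′ = subst (0 <_) (sym (ones-build (suc n) c))
        (subst (0 <_) (build-zeros (suc n) (dec c)) (≤-trans (s≤s z≤n) (m≤n+m (length (dec c)) (ones (build (suc n) (dec c))))))
      fails : ¬ Condition* (false ∷ δ)
      fails = chain⇒fails (false ∷ δ) refl (lookup-last (false ∷ δ) (trans e′ last))
        (subst (λ w → 0 < ones w) (sym e′) ones-pos′)
        (subst Chain (sym e′) (build-chain g m≤g all′))

lower-bound : ∀ n → 2 ^ n ≤ suc (n * length (failing (suc n)))
lower-bound n = subst₂ _≤_ (length-words n)
  (cong suc (trans (length-map inj₂ pairs) (trans (length-pairs (upTo n) (failing (suc n))) (cong (_* length (failing (suc n))) (length-upTo n)))))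
  (length-≤ (Lower._~_ n) (words-unique n) (Lower.~-total n) (Lower.~-injective n))
  where
  pairs = cartesianProduct (upTo n) (failing (suc n))

-- The bounds and the limit

+-minus-+ : ∀ {m n} → n ≤ m → + m - + n ≡ + (m ∸ n)
+-minus-+ {m} {n} n≤m = trans (ℤ.m-n≡m⊖n m n) (ℤ.⊖-≥ n≤m)

f≡failing : ∀ n → f (suc n) ≡ + length (failing n)
f≡failing n = begin
  + (2 ^ n) - + N (suc n)                                    ≡⟨ cong (λ k → + k - + N (suc n)) (N+failing n) ⟨
  + (N (suc n) + length (failing n)) - + N (suc n)           ≡⟨ +-minus-+ (m≤m+n (N (suc n)) _) ⟩
  + (N (suc n) + length (failing n) ∸ N (suc n))             ≡⟨ cong +_ (m+n∸m≡n (N (suc n)) _) ⟩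
  + length (failing n)                                       ∎
  where open ≡-Reasoning

/-≤-/1 : ∀ a c d → a ≤ c * suc d → (+ a) / suc d ≤ᵘ (+ c) / 1
/-≤-/1 a c d le = *≤* (subst₂ ℤ._≤_ (ℤ.pos-* a 1) (ℤ.pos-* c (suc d)) (+≤+ (≤-trans (≤-reflexive (*-identityʳ a)) le)))

/1-≤-/ : ∀ c a d → c * suc d ≤ a → (+ c) / 1 ≤ᵘ (+ a) / suc d
/1-≤-/ c a d le = *≤* (subst₂ ℤ._≤_ (ℤ.pos-* c (suc d)) (ℤ.pos-* a 1) (+≤+ (≤-trans le (≤-reflexive (sym (*-identityʳ a))))))

-- The distance from 1 is `k / D`. As `suc p` is at least 1, it suffices that this is below
-- `1 / suc q`.
near-1 : ∀ m k D .{{_ : NonZero D}} p q → m + k ≡ D → k * suc q < D → ∣ (+ m) / D -ᵘ 1ℚᵘ ∣ <ᵘ mkℚᵘ (+ suc p) q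
near-1 m k (suc d) p q m+k≡D lt = *<* (subst₂ ℤ._<_ lhs rhs (+<+ bound))
  where
  open ≡-Reasoning
  difference : + m ℤ.* + 1 ℤ.+ -[1+ 0 ] ℤ.* + suc d ≡ ℤ.- (+ k)
  difference = begin
    + m ℤ.* + 1 ℤ.+ -[1+ 0 ] ℤ.* + suc d  ≡⟨ cong₂ ℤ._+_ (ℤ.*-identityʳ (+ m)) (ℤ.-1*i≡-i (+ suc d)) ⟩
    + m - + suc d                         ≡⟨ cong (λ D → + m - + D) m+k≡D ⟨
    + m - + (m + k)                       ≡⟨ cong (λ z → + m ℤ.+ z) (ℤ.neg-distrib-+ (+ m) (+ k)) ⟩
    + m ℤ.+ (ℤ.- (+ m) ℤ.+ ℤ.- (+ k))     ≡⟨ ℤ.+-assoc (+ m) (ℤ.- (+ m)) (ℤ.- (+ k)) ⟨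
    (+ m - + m) ℤ.+ ℤ.- (+ k)             ≡⟨ cong (ℤ._+ ℤ.- (+ k)) (ℤ.+-inverseʳ (+ m)) ⟩
    + 0 ℤ.+ ℤ.- (+ k)                     ≡⟨ ℤ.+-identityˡ (ℤ.- (+ k)) ⟩
    ℤ.- (+ k)                             ∎
  lhs : + (k * suc q) ≡ + ℤ.∣ + m ℤ.* + 1 ℤ.+ -[1+ 0 ] ℤ.* + suc d ∣ ℤ.* + suc q
  lhs = trans (ℤ.pos-* k (suc q)) (cong (λ z → + z ℤ.* + suc q) (sym (trans (cong ℤ.∣_∣ difference) (ℤ.∣-i∣≡∣i∣ (+ k)))))
  rhs : + (suc p * suc (d * 1)) ≡ + suc p ℤ.* + suc (d * 1)
  rhs = ℤ.pos-* (suc p) (suc (d * 1))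
  bound : k * suc q < suc p * suc (d * 1)
  bound = ≤-trans lt (≤-trans (≤-reflexive (cong suc (sym (*-identityʳ d)))) (m≤m+n _ (p * suc (d * 1))))

theorem4p1 :
  ((g : ℕ) (3≤g : 3 ≤ g) →
      (((+ (2 ^ (g ∸ 2)) - + 1) / (g ∸ 2)) {{nonZero-g∸2 3≤g}} ≤ᵘ f g / 1)
    × (f g / 1 ≤ᵘ (+ (2 ^ (2 + g)) - + 2) / (2 + g)))
  × ((λ g → (+ (N g) / 2 ^ (g ∸ 1)) {{m^n≢0 2 (g ∸ 1)}}) ⟶ 1ℚᵘ)
theorem4p1 = bounds , limit
  where
  bounds : (g : ℕ) (3≤g : 3 ≤ g) →
           (((+ (2 ^ (g ∸ 2)) - + 1) / (g ∸ 2)) {{nonZero-g∸2 3≤g}} ≤ᵘ f g / 1)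
         × (f g / 1 ≤ᵘ (+ (2 ^ (2 + g)) - + 2) / (2 + g))
  bounds (suc (suc (suc m))) (s≤s (s≤s (s≤s z≤n))) =
    subst₂ (λ x y → x / suc m ≤ᵘ y / 1) (sym (+-minus-+ (m^n>0 2 (suc m)))) (sym (f≡failing (suc (suc m))))
      (/-≤-/1 (2 ^ suc m ∸ 1) F m (≤-trans (∸-monoˡ-≤ 1 (lower-bound (suc m))) (≤-reflexive (*-comm (suc m) F)))) ,
    subst₂ (λ x y → x / 1 ≤ᵘ y / (2 + g)) (sym (f≡failing (suc (suc m)))) (sym (+-minus-+ 2≤))
      (/1-≤-/ F (2 ^ (2 + g) ∸ 2) (suc g) (≤-trans (≤-reflexive (*-comm F (2 + g)))
        (≤-trans (≤-reflexive (sym (m+n∸m≡n 2 _))) (∸-monoˡ-≤ 2 (upper-bound (suc (suc m)))))))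
    where
    g = suc (suc (suc m))
    F = length (failing (suc (suc m)))
    2≤ : 2 ≤ 2 ^ (2 + g)
    2≤ = ≤-trans (m≤m+n 2 _) (upper-bound (suc (suc m)))

  limit : (λ g → (+ (N g) / 2 ^ (g ∸ 1)) {{m^n≢0 2 (g ∸ 1)}}) ⟶ 1ℚᵘ
  limit (mkℚᵘ (+ zero)   q) (*<* (+<+ ()))
  limit (mkℚᵘ -[1+ _ ]   q) (*<* ())
  -- The upper bound gives `(2 + g) * F < 2 ^ (2 + g)`, and the right side is 8 times `2 ^ (g ∸ 1)`.
  -- The distance from 1 is thus below `8 / (2 + g)`, hence below `1 / suc q` once `g` is at least
  -- `8 * suc q`.
  limit (mkℚᵘ (+ suc p) q) _ = 8 * suc q , close
    where
    close : ∀ g → 8 * suc q ≤ g → ∣ ((+ (N g)) / 2 ^ (g ∸ 1)) {{m^n≢0 2 (g ∸ 1)}} -ᵘ 1ℚᵘ ∣ <ᵘ mkℚᵘ (+ suc p) q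
    close (suc n) G≤g = near-1 (N (suc n)) F (2 ^ n) {{m^n≢0 2 n}} p q (N+failing n)
      (*-cancelʳ-< 8 _ _ (begin-strict
        F * suc q * 8       ≡⟨ *-assoc F (suc q) 8 ⟩
        F * (suc q * 8)     ≡⟨ cong (F *_) (*-comm (suc q) 8) ⟩
        F * (8 * suc q)     ≤⟨ *-monoʳ-≤ F (m≤n⇒m≤1+n (m≤n⇒m≤1+n G≤g)) ⟩
        F * (2 + suc n)     ≡⟨ *-comm F (2 + suc n) ⟩
        (2 + suc n) * F     <⟨ n<1+n _ ⟩
        1 + (2 + suc n) * F <⟨ upper-bound n ⟩
        2 ^ (3 + n)         ≡⟨ ^-distribˡ-+-* 2 3 n ⟩
        8 * 2 ^ n           ≡⟨ *-comm 8 (2 ^ n) ⟩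
        2 ^ n * 8           ∎))
      where
      open ≤-Reasoning
      F = length (failing n)
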